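{- Let $T$ be a tree on $n \ge 4$ vertices with edge set $\{e_1,\ldots,e_{n-1}\}$ and let $k$ be an integer such that $3 \le k \le n-3$. Then the data $\theta_T(\{e_{i_1},\ldots,e_{i_k}\})$ for all choices of $k$ distinct edges $e_{i_1},\ldots,e_{i_k}$ uniquely determines $T$. That is: if $T'$ is another tree on $n$ vertices with edge set $\{e'_1,\ldots,e'_{n-1}\}$ such that $\theta_T(\{e_i : i \in I\}) = \theta_{T'}(\{e'_i : i \in I\})$ for every $I \subseteq \{1,\ldots,n-1\}$ with $|I| = k$, then $T$ and $T'$ are isomorphic.
   Context: For a tree $T$ on $n$ vertices with edge set $E$ and a subset $S \subseteq E$, $\theta_T(S)$ denotes the integer partition of $n$ (of $|S|+1$ parts) whose parts are the numbers of vertices of the connected components of the graph obtained from $T$ by removing every edge of $S$ (keeping all vertices). The data considered is labeled: for each $k$-element subset $S$ of edges one knows the corresponding partition $\theta_T(S)$, not merely the multiset of all these partitions. -}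

module Defs where

open import Data.Nat.Base using (ℕ; suc; _≤_)
open import Data.Bool.Properties using () renaming (_≟_ to _≟ᵇ_)
open import Data.Fin.Base using (Fin; zero; suc)
open import Data.Fin.Permutation using (Permutation′; _⟨$⟩ʳ_)
open import Data.Fin.Properties using (_≟_)
open import Data.Fin.Subset using (Subset; inside; outside; _∉_; ⊥; ∣_∣)
open import Data.List.Base using (List; []; _∷_; [_]; _++_; map; length; allFin; deduplicate)
open import Data.List.Relation.Unary.Linked using (Linked)
open import Data.List.Relation.Unary.Unique.Propositional using (Unique)
open import Data.Product.Base using (Σ-syntax; ∃-syntax; _×_; _,_; proj₁; proj₂)
open import Data.Sum.Base using (_⊎_; inj₁; inj₂)
open import Data.Vec.Base using ([]; _∷_; tabulate; here; there)
open import Data.Vec.Properties using (≡-dec)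
open import Function.Base using (_∘_; id)
open import Function.Bundles using (_⇔_)
open import Relation.Binary.Construct.Closure.ReflexiveTransitive using (Star; ε; _◅_; _◅◅_; gmap)
open import Relation.Binary.Core using (Rel)
open import Relation.Binary.Definitions using (Decidable; DecidableEquality)
open import Relation.Binary.PropositionalEquality.Core using (_≡_; _≢_; refl)
open import Relation.Nullary.Decidable using (does; map′; _×-dec_; _⊎-dec_)
open import Relation.Nullary.Negation using (¬_; contradiction)
open import Level using (0ℓ)

private
  variable
    m n : ℕ

-- Edges are unordered pairs: each is stored with an arbitrary orientation,
-- which Joins forgets.
Joins : Fin n × Fin n → Rel (Fin n) 0ℓ
Joins p u v = p ≡ (u , v) ⊎ p ≡ (v , u)

-- A finite simple graph on the vertex set Fin n whose edge set is
-- enumerated without repetition as e_0, …, e_{m-1}.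
record Graph (n m : ℕ) : Set where
  field
    ends     : Fin m → Fin n × Fin n
    loopless : ∀ e → proj₁ (ends e) ≢ proj₂ (ends e)
    simple   : ∀ {e f u v} → Joins (ends e) u v → Joins (ends f) u v → e ≡ f

open Graph public using (ends)

AdjacentOff : (Fin m → Fin n × Fin n) → Subset m → Rel (Fin n) 0ℓ
AdjacentOff es S u v = ∃[ e ] e ∉ S × Joins (es e) u v

-- Adjacency in the graph obtained from G by deleting the edges in S and
-- keeping all vertices.
Adjacent∖ : Graph n m → Subset m → Rel (Fin n) 0ℓ
Adjacent∖ G = AdjacentOff (ends G)

Adjacent : Graph n m → Rel (Fin n) 0ℓ
Adjacent G = Adjacent∖ G ⊥

Reachable∖ : Graph n m → Subset m → Rel (Fin n) 0ℓ
Reachable∖ G S = Star (Adjacent∖ G S)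

Connected : Graph n m → Set
Connected G = ∀ u v → Star (Adjacent G) u v

-- The vertices v ∷ vs, in cyclic order, form a cycle (of length at least 3).
IsCycle : Graph n m → Fin n → List (Fin n) → Set
IsCycle G v vs =
  2 ≤ length vs × Unique (v ∷ vs) × Linked (Adjacent G) (v ∷ vs ++ [ v ])

Acyclic : Graph n m → Set
Acyclic G = ∀ v vs → ¬ IsCycle G v vs

IsTree : Graph n m → Set
IsTree G = Connected G × Acyclic G

-- Isomorphism as graphs: the edge enumerations need not correspond.
Isomorphic : Graph n m → Graph n m → Set
Isomorphic {n} G H =
  Σ[ π ∈ Permutation′ n ]
    (∀ u v → Adjacent G u v ⇔ Adjacent H (π ⟨$⟩ʳ u) (π ⟨$⟩ʳ v))

-- Reachability is decided by adding the edges outside S one at a time: a walk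
-- may be assumed to cross the newly added edge p at most once.
private
  Cross : Fin n × Fin n → Rel (Fin n) 0ℓ → Rel (Fin n) 0ℓ
  Cross (a , b) R u v = R u v ⊎ (R u a × R b v) ⊎ (R u b × R a v)

  module _ (es : Fin (suc m) → Fin n × Fin n) (S : Subset m) where

    old : ∀ {s u v} → AdjacentOff (es ∘ suc) S u v → AdjacentOff es (s ∷ S) u v
    old (e , e∉S , j) = suc e , (λ { (there e∈S) → e∉S e∈S }) , j

    fewer : ∀ {u v} → AdjacentOff es (inside ∷ S) u v → AdjacentOff (es ∘ suc) S u v
    fewer (zero  , e∉S , j) = contradiction here e∉S
    fewer (suc e , e∉S , j) = e , e∉S ∘ there , j

    R : Rel (Fin n) 0ℓ
    R = Star (AdjacentOff (es ∘ suc) S)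

    cross⁺ : ∀ {u v} → Star (AdjacentOff es (outside ∷ S)) u v → Cross (es zero) R u v
    cross⁺ ε = inj₁ ε
    cross⁺ ((suc e , e∉S , j) ◅ w) with cross⁺ w
    ... | inj₁ q              = inj₁ ((e , e∉S ∘ there , j) ◅ q)
    ... | inj₂ (inj₁ (q , r)) = inj₂ (inj₁ ((e , e∉S ∘ there , j) ◅ q , r))
    ... | inj₂ (inj₂ (q , r)) = inj₂ (inj₂ ((e , e∉S ∘ there , j) ◅ q , r))
    cross⁺ ((zero , _ , j) ◅ w) with es zero | j | cross⁺ w
    ... | _ | inj₁ refl | inj₁ q              = inj₂ (inj₁ (ε , q))
    ... | _ | inj₁ refl | inj₂ (inj₁ (q , r)) = inj₂ (inj₁ (ε , r))
    ... | _ | inj₁ refl | inj₂ (inj₂ (q , r)) = inj₁ r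
    ... | _ | inj₂ refl | inj₁ q              = inj₂ (inj₂ (ε , q))
    ... | _ | inj₂ refl | inj₂ (inj₁ (q , r)) = inj₁ r
    ... | _ | inj₂ refl | inj₂ (inj₂ (q , r)) = inj₂ (inj₂ (ε , r))

    cross⁻ : ∀ {u v} → Cross (es zero) R u v → Star (AdjacentOff es (outside ∷ S)) u v
    cross⁻ (inj₁ q)              = gmap id old q
    cross⁻ (inj₂ (inj₁ (q , r))) =
      gmap id old q ◅◅ (zero , (λ ()) , inj₁ refl) ◅ gmap id old r
    cross⁻ (inj₂ (inj₂ (q , r))) =
      gmap id old q ◅◅ (zero , (λ ()) , inj₂ refl) ◅ gmap id old r

starOff? : (es : Fin m → Fin n × Fin n) (S : Subset m) → Decidable (Star (AdjacentOff es S))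
starOff? es [] u v = map′ (λ { refl → ε }) (λ { ε → refl ; ((() , _) ◅ _) }) (u ≟ v)
starOff? es (inside ∷ S) u v =
  map′ (gmap id (old es S)) (gmap id (fewer es S)) (starOff? (es ∘ suc) S u v)
starOff? es (outside ∷ S) u v =
  map′ (cross⁻ es S) (cross⁺ es S)
    (u ⇝? v ⊎-dec (u ⇝? a ×-dec b ⇝? v) ⊎-dec (u ⇝? b ×-dec a ⇝? v))
  where
  infix 5 _⇝?_
  a = proj₁ (es zero)
  b = proj₂ (es zero)
  _⇝?_ = starOff? (es ∘ suc) S

reachable∖? : (G : Graph n m) (S : Subset m) → Decidable (Reachable∖ G S)
reachable∖? G = starOff? (ends G)

component : Graph n m → Subset m → Fin n → Subset n
component G S u = tabulate λ v → does (reachable∖? G S u v)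

_≟ˢ_ : DecidableEquality (Subset n)
_≟ˢ_ = ≡-dec _≟ᵇ_

components : Graph n m → Subset m → List (Subset n)
components {n} G S = deduplicate _≟ˢ_ (map (component G S) (allFin n))

-- The parts of the partition, in no particular order; partitions are to be
-- compared up to permutation _↭_.
θ : Graph n m → Subset m → List ℕ
θ G S = map ∣_∣ (components G S)

{-# OPTIONS --safe #-}
module Submission where

-- The data for k determine the data for k − 1 as long as k ≤ n − 3. Suppose
-- that θ_T(I) ≠ θ_T′(I) with |I| = k − 1, and let v be the largest part whose
-- multiplicities differ, say larger in T. Removing one more edge splits a part
-- in both trees with equal results. Applied to edges that cut off a single
-- vertex, this forces θ_T(I) = {v, 1, …, 1} with v ≥ 4, and every edge cutting
-- a leaf off the large component of T must split a part 2 = 1 + 1 in T′. There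
-- are at least two such edges, but θ_T′(I) has only one part 2.
--
-- So the data for 1, 2 and 3 edges agree. Root both trees at the leaf of a leaf
-- edge o. The data for {e} give the number c of vertices below e up to
-- c ↔ n − c, those for {o, e} up to c ↔ n − 1 − c, hence c is known. Similarly,
-- {e, f} tells whether f lies below e unless n = 2c, and {o, e, f} tells it
-- unless n − 1 = 2c. The tree is determined by this order on its edges, since
-- each vertex other than the root is the lower end of exactly one edge.

open import Defs
open import Data.Bool.Base using (if_then_else_)
open import Data.Fin.Base using (Fin; zero; suc)
import Data.Fin.Properties as Fin
open import Data.Fin.Subset using (Subset; inside; outside; _∈_; _∉_; _⊆_; ⊥; ⁅_⁆; _∪_; _-_; ∣_∣)
open import Data.Fin.Subset.Properties
  using (x∈⁅x⁆; x∈⁅y⁆⇒x≡y; ∣⁅x⁆∣≡1; ∣⊥∣≡0; ∉⊥; p⊆p∪q; q⊆p∪q; x∈p∪q⁻; ⊆-antisym; p─q⊆p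
        ; x∈p∧x≢y⇒x∈p-y; p⊂q⇒∣p∣<∣q∣; p⊆q⇒∣p∣≤∣q∣; nonempty?; ⊆⊤; ∣⊤∣≡n; Empty-unique)
open import Data.List.Base using (List; []; _∷_; [_]; _++_; map; length; allFin)
open import Data.List.Membership.Propositional using () renaming (_∈_ to _∈ˡ_)
open import Data.List.Membership.Propositional.Properties
  using (∈-∃++; ∈-map⁺; ∈-map⁻; ∈-allFin; ∈-deduplicate⁺; ∈-deduplicate⁻)
open import Data.List.Membership.Propositional.Properties.WithK using (unique∧set⇒bag)
open import Data.List.Properties
  using (map-cong-local; map-∘; map-++; length-map; ++-identityʳ; length-++)
open import Data.List.Relation.Binary.BagAndSetEquality using (∼bag⇒↭)
open import Data.List.Relation.Binary.Permutation.Propositional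
  using (_↭_; ↭⇒↭ₛ; ↭-refl; ↭-sym; ↭-trans; ↭-reflexive; prep; swap)
open import Data.List.Relation.Binary.Permutation.Propositional.Properties
  using (map⁺; shift; ∈-resp-↭; ↭-length; drop-∷; ++-comm)
open import Data.List.Relation.Binary.Permutation.Setoid.Properties using (AllPairs-resp-↭)
open import Data.List.Relation.Unary.All as All using (All; []; _∷_)
open import Data.List.Relation.Unary.All.Properties using (¬Any⇒All¬)
open import Data.List.Relation.Unary.AllPairs using (AllPairs; []; _∷_)
import Data.List.Relation.Unary.AllPairs as AllPairs
import Data.List.Relation.Unary.AllPairs.Properties as AllPairs
open import Data.List.Relation.Unary.Any as Any using (Any; here; there)
import Data.List.Relation.Unary.Any.Properties as Any
open import Data.List.Relation.Unary.Linked using (Linked; []; [-]; _∷_)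
open import Data.List.Relation.Unary.Unique.DecPropositional.Properties using (deduplicate-!)
open import Data.List.Relation.Unary.Unique.Propositional using (Unique)
open import Data.Nat.Base
open import Data.Nat.Induction using (<-wellFounded)
open import Data.Nat.ListAction using (sum)
open import Data.Nat.ListAction.Properties using (sum-↭)
open import Data.Nat.Properties
open import Data.Product.Base using (∃-syntax; ∃₂; _×_; _,_; proj₁; proj₂)
open import Data.Sum.Base using (_⊎_; inj₁; inj₂; [_,_]′)
import Data.Vec.Base as Vec
open import Data.Vec.Properties using (lookup∘tabulate; []=⇒lookup; lookup⇒[]=)
open import Function.Base using (_∘_; id; case_of_)
open import Function.Bundles using (mk⇔)
open import Induction.WellFounded using (Acc; acc)
open import Relation.Binary.Construct.Closure.ReflexiveTransitive
  using (Star; ε; _◅_; _◅◅_; gmap; reverse)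
open import Relation.Binary.Core using (Rel)
open import Relation.Binary.PropositionalEquality hiding ([_])
open import Relation.Nullary using (¬_; Dec; yes; no; does; contradiction)
open import Relation.Nullary.Decidable using (dec-true; dec-false; _×-dec_; ¬?; decidable-stable)
open import Level using (0ℓ)
open import Data.Nat.Tactic.RingSolver using (solve-∀)
import Data.Empty as Empty
open import Relation.Binary.Definitions using (tri<; tri≈; tri>)
open import Data.Fin.Permutation using (permutation)

private
  variable
    n m : ℕ

-- Multiplicities in lists of numbers

δ : ℕ → ℕ → ℕ
δ x y = if does (x ≟ y) then 1 else 0

δ-refl : ∀ x → δ x x ≡ 1
δ-refl x = cong (if_then 1 else 0) (dec-true (x ≟ x) refl)

δ-≢ : ∀ {x y} → x ≢ y → δ x y ≡ 0
δ-≢ {x} {y} x≢y = cong (if_then 1 else 0) (dec-false (x ≟ y) x≢y)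

occ : ℕ → List ℕ → ℕ
occ x xs = sum (map (δ x) xs)

occ-resp-↭ : ∀ x {xs ys} → xs ↭ ys → occ x xs ≡ occ x ys
occ-resp-↭ x = sum-↭ ∘ map⁺ (δ x)

occ⇒∈ : ∀ {x} xs → occ x xs ≢ 0 → x ∈ˡ xs
occ⇒∈     []       nz = contradiction refl nz
occ⇒∈ {x} (y ∷ xs) nz with x ≟ y
... | yes x≡y = here x≡y
... | no  x≢y = there (occ⇒∈ xs λ z → nz (trans (cong (_+ occ x xs) (δ-≢ x≢y)) z))

∈⇒occ : ∀ {x xs} → x ∈ˡ xs → 1 ≤ occ x xs
∈⇒occ {x} (here {xs = xs} refl) = ≤-trans (≤-reflexive (sym (δ-refl x))) (m≤m+n _ (occ x xs))
∈⇒occ {x} (there {y} x∈xs)      = ≤-trans (∈⇒occ x∈xs) (m≤n+m _ (δ x y))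

occ≡⇒↭ : ∀ xs ys → (∀ x → occ x xs ≡ occ x ys) → xs ↭ ys
occ≡⇒↭ []       []       _  = ↭-refl
occ≡⇒↭ []       (y ∷ ys) eq = contradiction (∈⇒occ {xs = y ∷ ys} (here refl)) (<⇒≱ (s≤s (≤-reflexive (sym (eq y)))))
occ≡⇒↭ (x ∷ xs) ys       eq
  with as , bs , refl ← ∈-∃++ (occ⇒∈ {x} ys (>⇒≢ (≤-trans (∈⇒occ {xs = x ∷ xs} (here refl)) (≤-reflexive (eq x)))))
  = ↭-trans (prep x (occ≡⇒↭ xs (as ++ bs) λ z →
      +-cancelˡ-≡ (δ z x) _ _ (trans (eq z) (occ-resp-↭ z (shift x as bs)))))
      (↭-sym (shift x as bs))

∈⇒≤sum : ∀ {x xs} → x ∈ˡ xs → x ≤ sum xs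
∈⇒≤sum (here refl)        = m≤m+n _ _
∈⇒≤sum (there {y} x∈xs) = ≤-trans (∈⇒≤sum x∈xs) (m≤n+m _ y)

AgreeAbove : ℕ → List ℕ → List ℕ → Set
AgreeAbove v xs ys = ∀ x → v < x → occ x xs ≡ occ x ys

-- A downward search for a disagreement. It starts above both sums, where nothing occurs in either
-- list; if it reaches 0 without success, all multiplicities agree.
↭-or-largest-difference : ∀ xs ys →
  xs ↭ ys ⊎ ∃[ v ] occ v xs ≢ occ v ys × AgreeAbove v xs ys
↭-or-largest-difference xs ys = go (suc (sum xs + sum ys)) λ x big →
    trans (absent xs (≤-trans (s≤s (m≤m+n _ _)) big)) (sym (absent ys (≤-trans (s≤s (m≤n+m _ (sum xs))) big)))
  where
  absent : ∀ {x} zs → sum zs < x → occ x zs ≡ 0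
  absent {x} zs big with occ x zs ≟ 0
  ... | yes z = z
  ... | no nz = contradiction (∈⇒≤sum (occ⇒∈ zs nz)) (<⇒≱ big)
  go : ∀ b → (∀ x → b ≤ x → occ x xs ≡ occ x ys) →
       xs ↭ ys ⊎ ∃[ v ] occ v xs ≢ occ v ys × AgreeAbove v xs ys
  go zero    eq = inj₁ (occ≡⇒↭ xs ys λ x → eq x z≤n)
  go (suc b) eq with occ b xs ≟ occ b ys
  ... | no  ≢b = inj₂ (b , ≢b , eq)
  ... | yes ≡b = go b λ x b≤x → case m≤n⇒m<n∨m≡n b≤x of λ
    { (inj₁ b<x) → eq x b<x ; (inj₂ refl) → ≡b }

-- Subsets with one element added or removed

infixl 6 _⊕_
_⊕_ : Subset m → Fin m → Subset m
S ⊕ e = S ∪ ⁅ e ⁆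

⊆-⊕ : {S : Subset m} (e : Fin m) → S ⊆ S ⊕ e
⊆-⊕ e = p⊆p∪q ⁅ e ⁆

∈-⊕ : {S : Subset m} (e : Fin m) → e ∈ S ⊕ e
∈-⊕ {S = S} e = q⊆p∪q S ⁅ e ⁆ (x∈⁅x⁆ e)

∈-⊕⁻ : {S : Subset m} {e f : Fin m} → f ∈ S ⊕ e → f ∈ S ⊎ f ≡ e
∈-⊕⁻ {S = S} {e} f∈ with x∈p∪q⁻ S ⁅ e ⁆ f∈
... | inj₁ f∈S = inj₁ f∈S
... | inj₂ f∈e = inj₂ (x∈⁅y⁆⇒x≡y e f∈e)

∉-⊕ : {S : Subset m} {e f : Fin m} → f ∉ S → f ≢ e → f ∉ S ⊕ e
∉-⊕ f∉S f≢e f∈ = [ f∉S , f≢e ]′ (∈-⊕⁻ f∈)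

⊕-⊆ : {S S′ : Subset m} {e : Fin m} → S ⊆ S′ → e ∈ S′ → S ⊕ e ⊆ S′
⊕-⊆ S⊆ e∈ f∈ with ∈-⊕⁻ f∈
... | inj₁ f∈S  = S⊆ f∈S
... | inj₂ refl = e∈

∣∪∣-disjoint : (p q : Subset n) → (∀ {x} → x ∈ p → x ∉ q) → ∣ p ∪ q ∣ ≡ ∣ p ∣ + ∣ q ∣
∣∪∣-disjoint Vec.[]              Vec.[]              dis = refl
∣∪∣-disjoint (inside  Vec.∷ p) (inside  Vec.∷ q) dis = contradiction Vec.here (dis Vec.here)
∣∪∣-disjoint (inside  Vec.∷ p) (outside Vec.∷ q) dis =
  cong suc (∣∪∣-disjoint p q λ x∈p x∈q → dis (Vec.there x∈p) (Vec.there x∈q))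
∣∪∣-disjoint (outside Vec.∷ p) (inside  Vec.∷ q) dis =
  trans (cong suc (∣∪∣-disjoint p q λ x∈p x∈q → dis (Vec.there x∈p) (Vec.there x∈q))) (sym (+-suc _ _))
∣∪∣-disjoint (outside Vec.∷ p) (outside Vec.∷ q) dis =
  ∣∪∣-disjoint p q λ x∈p x∈q → dis (Vec.there x∈p) (Vec.there x∈q)

∣⊕∣ : {S : Subset m} {e : Fin m} → e ∉ S → ∣ S ⊕ e ∣ ≡ suc ∣ S ∣
∣⊕∣ {S = S} {e} e∉S = trans
  (∣∪∣-disjoint S ⁅ e ⁆ λ x∈S x∈e → e∉S (subst (_∈ S) (x∈⁅y⁆⇒x≡y e x∈e) x∈S))
  (trans (cong (∣ S ∣ +_) (∣⁅x⁆∣≡1 e)) (+-comm ∣ S ∣ 1))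

∉-remove : (S : Subset m) (e : Fin m) → e ∉ S - e
∉-remove (inside  Vec.∷ S) zero    ()
∉-remove (outside Vec.∷ S) zero    ()
∉-remove (_ Vec.∷ S) (suc e) (Vec.there e∈) = ∉-remove S e e∈

remove-⊕ : {S : Subset m} {e : Fin m} → e ∈ S → (S - e) ⊕ e ≡ S
remove-⊕ {S = S} {e} e∈S = ⊆-antisym
  (⊕-⊆ (p─q⊆p S ⁅ e ⁆) e∈S)
  λ {f} f∈S → case f Fin.≟ e of λ
    { (yes refl) → ∈-⊕ e
    ; (no f≢e)   → ⊆-⊕ e (x∈p∧x≢y⇒x∈p-y f∈S f≢e) }

-- Ends of edges and simple paths

Joins-sym : ∀ {p : Fin n × Fin n} {u v} → Joins p u v → Joins p v u
Joins-sym (inj₁ eq) = inj₂ eq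
Joins-sym (inj₂ eq) = inj₁ eq

Joins-ends : ∀ {p : Fin n × Fin n} {u v x y} → Joins p u v → Joins p x y →
  (x ≡ u × y ≡ v) ⊎ (x ≡ v × y ≡ u)
Joins-ends (inj₁ refl) (inj₁ refl) = inj₁ (refl , refl)
Joins-ends (inj₁ refl) (inj₂ refl) = inj₂ (refl , refl)
Joins-ends (inj₂ refl) (inj₁ refl) = inj₂ (refl , refl)
Joins-ends (inj₂ refl) (inj₂ refl) = inj₁ (refl , refl)

-- The list holds the vertices after the start, which is the form that `IsCycle` expects.
data Path (_~_ : Rel (Fin n) 0ℓ) : Fin n → List (Fin n) → Fin n → Set where
  stop : ∀ {u} → Path _~_ u [] u
  step : ∀ {u w vs v} → u ~ w → Path _~_ w vs v → Path _~_ u (w ∷ vs) v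

module _ {_~_ : Rel (Fin n) 0ℓ} where

  suffix : ∀ {w vs v u} → Path _~_ w vs v → Unique (w ∷ vs) → u ∈ˡ w ∷ vs →
    ∃[ us ] Path _~_ u us v × Unique (u ∷ us)
  suffix {vs = vs} p uniq (here refl) = vs , p , uniq
  suffix (step _ p) (_ ∷ uniq) (there u∈) = suffix p uniq u∈

  -- Loop erasure: if the start recurs on the path already made simple, everything before the
  -- recurrence is dropped.
  simple-path : ∀ {u v} → Star _~_ u v → ∃[ vs ] Path _~_ u vs v × Unique (u ∷ vs)
  simple-path ε = [] , stop , [] ∷ []
  simple-path {u} (_◅_ {j = w} u~w walk) with simple-path walk
  ... | vs , p , uniq with Any.any? (u Fin.≟_) (w ∷ vs)
  ...   | yes u∈ = suffix p uniq u∈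
  ...   | no  u∉ = w ∷ vs , step u~w p , ¬Any⇒All¬ _ u∉ ∷ uniq

  close : ∀ {_≈_ : Rel (Fin n) 0ℓ} {u vs v z} → (∀ {x y} → x ~ y → x ≈ y) →
    Path _~_ u vs v → v ≈ z → Linked _≈_ (u ∷ vs ++ [ z ])
  close _ stop       v≈z = v≈z ∷ [-]
  close f (step a p) v≈z = f a ∷ close f p v≈z

-- Components of a tree after the removal of edges

module Tree {n m : ℕ} (G : Graph n m) (tree : IsTree G) where

  open Graph G using (loopless; simple)

  R : Subset m → Rel (Fin n) 0ℓ
  R = Reachable∖ G

  R? : ∀ S u v → Dec (R S u v)
  R? = reachable∖? G

  R-sym : ∀ {S u v} → R S u v → R S v u
  R-sym = reverse λ (e , e∉S , j) → e , e∉S , Joins-sym j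

  R-mono : ∀ {S S′ u v} → S ⊆ S′ → R S′ u v → R S u v
  R-mono S⊆S′ = gmap id λ (e , e∉ , j) → e , (λ e∈S → e∉ (S⊆S′ e∈S)) , j

  edge : ∀ {S e u v} → e ∉ S → Joins (ends G e) u v → R S u v
  edge {e = e} e∉S j = (e , e∉S , j) ◅ ε

  connected : ∀ u v → R ⊥ u v
  connected = proj₁ tree

  loopless′ : ∀ {e u} → ¬ Joins (ends G e) u u
  loopless′ {e} (inj₁ eq) = loopless e (trans (cong proj₁ eq) (sym (cong proj₂ eq)))
  loopless′ {e} (inj₂ eq) = loopless e (trans (cong proj₁ eq) (sym (cong proj₂ eq)))

  -- One crossing of `e` suffices: two crossings in the same direction are shortened to one, and two
  -- in opposite directions cancel.
  cross : ∀ {S u v} e → R S u v → R (S ⊕ e) u v ⊎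
    ∃₂ λ x y → Joins (ends G e) x y × R (S ⊕ e) u x × R (S ⊕ e) y v
  cross e ε = inj₁ ε
  cross {u = u} e (_◅_ {j = w} (f , f∉S , j) walk) with f Fin.≟ e | cross e walk
  ... | no f≢e   | inj₁ q                   = inj₁ ((f , ∉-⊕ f∉S f≢e , j) ◅ q)
  ... | no f≢e   | inj₂ (x , y , j′ , q , r) = inj₂ (x , y , j′ , (f , ∉-⊕ f∉S f≢e , j) ◅ q , r)
  ... | yes refl | inj₁ q                   = inj₂ (u , w , j , ε , q)
  ... | yes refl | inj₂ (x , y , j′ , q , r) with Joins-ends j j′
  ...   | inj₁ (refl , refl) = inj₂ (u , w , j , ε , r)
  ...   | inj₂ (refl , refl) = inj₁ r

  -- A simple path between the ends of `e` that avoids `e` would be empty and make `e` a loop, or be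
  -- a single edge parallel to `e`, or form a cycle together with `e`.
  bridge : ∀ {S e u v} → e ∈ S → Joins (ends G e) u v → ¬ R S u v
  bridge {S} {e} {u} {v} e∈S j walk with simple-path walk
  ... | [] , stop , _ = loopless′ j
  ... | w ∷ [] , step (f , f∉S , j′) stop , _ = f∉S (subst (_∈ S) (simple j j′) e∈S)
  ... | vs@(_ ∷ _ ∷ _) , p , uniq = proj₂ tree u vs
    ( s≤s (s≤s z≤n) , uniq
    , close (λ (f , _ , j′) → f , ∉⊥ , j′) p (e , ∉⊥ , Joins-sym j))

  -- None of the edges removed in passing from `S` to `S′` touches the component of `w`, which
  -- therefore survives intact (`sz-stable`).
  Far : Subset m → Subset m → Fin n → Set
  Far S S′ w = ∀ {g x y} → g ∈ S′ → g ∉ S → Joins (ends G g) x y → ¬ R S w x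

  far-⊕ : ∀ {S e w} → (∀ {x y} → Joins (ends G e) x y → ¬ R S w x) → Far S (S ⊕ e) w
  far-⊕ far g∈ g∉S j with ∈-⊕⁻ g∈
  ... | inj₁ g∈S  = contradiction g∈S g∉S
  ... | inj₂ refl = far j

  avoids : ∀ {S S′ w v} → Far S S′ w → R S w v → R S′ w v
  avoids far ε = ε
  avoids far ((g , g∉S , j) ◅ walk) =
    (g , (λ g∈ → far g∈ g∉S j ε) , j) ◅
    avoids (λ g∈ g∉S′ j′ r → far g∈ g∉S′ j′ ((g , g∉S , j) ◅ r)) walk

  comp : Subset m → Fin n → Subset n
  comp = component G

  sz : Subset m → Fin n → ℕ
  sz S u = ∣ comp S u ∣

  ∈-comp⁺ : ∀ {S u v} → R S u v → v ∈ comp S u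
  ∈-comp⁺ {S} {u} {v} r = lookup⇒[]= v _ (trans (lookup∘tabulate _ v) (dec-true (R? S u v) r))

  ∈-comp⁻ : ∀ S u {v} → v ∈ comp S u → R S u v
  ∈-comp⁻ S u {v} v∈ with R? S u v | trans (sym (lookup∘tabulate (λ v → does (R? S u v)) v)) ([]=⇒lookup v∈)
  ... | yes r | _ = r

  comp-cong : ∀ {S S′ u u′} → (∀ v → R S u v → R S′ u′ v) → (∀ v → R S′ u′ v → R S u v) →
    comp S u ≡ comp S′ u′
  comp-cong {S} {S′} {u} {u′} f g = ⊆-antisym
    (λ v∈ → ∈-comp⁺ (f _ (∈-comp⁻ S u v∈)))
    (λ v∈ → ∈-comp⁺ (g _ (∈-comp⁻ S′ u′ v∈)))

  comp-≡ : ∀ {S u v} → R S u v → comp S u ≡ comp S v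
  comp-≡ r = comp-cong (λ _ → R-sym r ◅◅_) (λ _ → r ◅◅_)

  comp-≡⁻ : ∀ {S u v} → comp S u ≡ comp S v → R S u v
  comp-≡⁻ {S} {u} {v} eq = ∈-comp⁻ S u (subst (v ∈_) (sym eq) (∈-comp⁺ {S} ε))

  sz-≡ : ∀ {S u v} → R S u v → sz S u ≡ sz S v
  sz-≡ {S} r = cong ∣_∣ (comp-≡ {S} r)

  sz-stable : ∀ {S S′ w} → S ⊆ S′ → Far S S′ w → sz S′ w ≡ sz S w
  sz-stable S⊆S′ far = cong ∣_∣ (comp-cong (λ _ → R-mono S⊆S′) (λ _ → avoids far))

  sz-pos : ∀ S u → 1 ≤ sz S u
  sz-pos S u = ≤-trans (≤-reflexive (sym (∣⁅x⁆∣≡1 u)))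
    (p⊆q⇒∣p∣≤∣q∣ λ v∈ → ∈-comp⁺ (subst (R S u) (sym (x∈⁅y⁆⇒x≡y u v∈)) ε))

  isolated⇒sz≡1 : ∀ {S u} → (∀ v → R S u v → v ≡ u) → sz S u ≡ 1
  isolated⇒sz≡1 {S} {u} alone = trans
    (cong ∣_∣ (⊆-antisym (λ {v} v∈ → subst (_∈ ⁅ u ⁆) (sym (alone v (∈-comp⁻ S u v∈))) (x∈⁅x⁆ u))
      (λ v∈ → ∈-comp⁺ (subst (R S u) (sym (x∈⁅y⁆⇒x≡y u v∈)) ε))))
    (∣⁅x⁆∣≡1 u)

  sz≡1⇒isolated : ∀ {S u} → sz S u ≡ 1 → ∀ v → R S u v → v ≡ u
  sz≡1⇒isolated {S} {u} one v r = decidable-stable (v Fin.≟ u) λ v≢u →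
    <-irrefl (trans (∣⁅x⁆∣≡1 u) (sym one)) (p⊂q⇒∣p∣<∣q∣
      ( (λ w∈ → ∈-comp⁺ (subst (R S u) (sym (x∈⁅y⁆⇒x≡y u w∈)) ε))
      , v , ∈-comp⁺ r , v≢u ∘ x∈⁅y⁆⇒x≡y u))

  -- Every vertex of the component is reached with at most one crossing of `e`, and by `bridge` no
  -- vertex lies on both sides.
  sz-split : ∀ {S e a b} → e ∉ S → Joins (ends G e) a b →
    sz S a ≡ sz (S ⊕ e) a + sz (S ⊕ e) b
  sz-split {S} {e} {a} {b} e∉S j = trans
    (cong ∣_∣ (⊆-antisym
      (λ v∈ → case cross e (∈-comp⁻ S a v∈) of λ
        { (inj₁ q) → p⊆p∪q _ (∈-comp⁺ q)
        ; (inj₂ (x , y , j′ , _ , r)) → case Joins-ends j j′ of λ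
          { (inj₁ (refl , refl)) → q⊆p∪q (comp (S ⊕ e) a) _ (∈-comp⁺ r)
          ; (inj₂ (refl , refl)) → p⊆p∪q _ (∈-comp⁺ r) } })
      (λ v∈ → ∈-comp⁺ (case x∈p∪q⁻ (comp (S ⊕ e) a) _ v∈ of λ
        { (inj₁ v∈a) → R-mono (⊆-⊕ e) (∈-comp⁻ (S ⊕ e) a v∈a)
        ; (inj₂ v∈b) → edge e∉S j ◅◅ R-mono (⊆-⊕ e) (∈-comp⁻ (S ⊕ e) b v∈b) }))))
    (∣∪∣-disjoint (comp (S ⊕ e) a) (comp (S ⊕ e) b) λ v∈a v∈b →
      bridge (∈-⊕ e) j (∈-comp⁻ (S ⊕ e) a v∈a ◅◅ R-sym (∈-comp⁻ (S ⊕ e) b v∈b)))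

  -- The partition read off from representatives of the components

  Separated : Subset m → List (Fin n) → Set
  Separated S = AllPairs λ u v → ¬ R S u v

  Reps : Subset m → List (Fin n) → Set
  Reps S us = Separated S us × (∀ v → Any (λ u → R S u v) us)

  -- This replaces the deduplication in `θ` by any choice of one vertex per component: both lists of
  -- components are free of repetitions and have the same members.
  θ-reps : ∀ {S us} → Reps S us → θ G S ↭ map (sz S) us
  θ-reps {S} {us} (sep , cover) = ↭-trans
    (map⁺ ∣_∣ (∼bag⇒↭ (unique∧set⇒bag (deduplicate-! _≟ˢ_ _)
      (AllPairs.map⁺ (AllPairs.map (_∘ comp-≡⁻) sep))
      (mk⇔ to from))))
    (↭-reflexive (sym (map-∘ us)))
    where
    to : ∀ {p} → p ∈ˡ components G S → p ∈ˡ map (comp S) us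
    to p∈ with v , _ , refl ← ∈-map⁻ (comp S) (∈-deduplicate⁻ _≟ˢ_ _ p∈) =
      Any.map⁺ (Any.map (comp-≡ ∘ R-sym) (cover v))
    from : ∀ {p} → p ∈ˡ map (comp S) us → p ∈ˡ components G S
    from p∈ with v , _ , refl ← ∈-map⁻ (comp S) p∈ =
      ∈-deduplicate⁺ _≟ˢ_ (∈-map⁺ (comp S) (∈-allFin v))

  -- Greedy choice: all vertices are inspected, and those not yet reached become representatives.
  extend : ∀ {S} us → Separated S us → ∃[ vs ] Reps S (us ++ vs)
  extend {S} us sep =
    let vs , sep′ , cov = go us sep (allFin n) in
    vs , AllPairs-resp-↭ (setoid (Fin n)) (λ ¬r r → ¬r (R-sym r)) (resp₂ _) (↭⇒↭ₛ (++-comm vs us)) sep′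
    , λ v → Any.++-comm vs us (cov (∈-allFin v))
    where
    go : ∀ us → Separated S us → ∀ ws →
      ∃[ vs ] Separated S (vs ++ us) × (∀ {v} → v ∈ˡ ws → Any (λ u → R S u v) (vs ++ us))
    go us sep [] = [] , sep , λ ()
    go us sep (w ∷ ws) with go us sep ws
    ... | vs , sep′ , cov with Any.any? (λ u → R? S u w) (vs ++ us)
    ...   | yes w∈ = vs , sep′ , λ { (here refl) → w∈ ; (there v∈) → cov v∈ }
    ...   | no  w∉ = w ∷ vs , All.map (λ ¬r r → ¬r (R-sym r)) (¬Any⇒All¬ _ w∉) ∷ sep′
                   , λ { (here refl) → here ε ; (there v∈) → there (cov v∈) }

  θ-separated : ∀ {S} us → Separated S us → ∃[ C ] θ G S ↭ map (sz S) us ++ C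
  θ-separated {S} us sep =
    let vs , reps = extend us sep in
    map (sz S) vs , ↭-trans (θ-reps reps) (↭-reflexive (map-++ (sz S) us vs))

  -- With `a` as the representative of its component, removing `e` requires only `b` as a new one.
  -- The other components do not meet `e`, so their sizes form the common rest `C`.
  θ-split : ∀ {S e a b} → e ∉ S → Joins (ends G e) a b → ∃[ C ]
    θ G S ↭ (sz (S ⊕ e) a + sz (S ⊕ e) b) ∷ C ×
    θ G (S ⊕ e) ↭ sz (S ⊕ e) a ∷ sz (S ⊕ e) b ∷ C
  θ-split {S} {e} {a} {b} e∉S j
    with vs , (far ∷ sep) , cover ← extend {S} [ a ] ([] ∷ [])
    = map (sz S) vs
    , ↭-trans (θ-reps ((far ∷ sep) , cover)) (↭-reflexive (cong (_∷ map (sz S) vs) (sz-split e∉S j)))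
    , ↭-trans (θ-reps reps′) (↭-reflexive (cong (λ C → sz (S ⊕ e) a ∷ sz (S ⊕ e) b ∷ C)
        (map-cong-local (All.map (λ ¬r → sz-stable (⊆-⊕ e) (far-⊕ (away ¬r))) far))))
    where
    b⇝a : R S b a
    b⇝a = edge e∉S (Joins-sym j)
    away : ∀ {v} → ¬ R S a v → ∀ {x y} → Joins (ends G e) x y → ¬ R S v x
    away ¬r j′ r with Joins-ends j j′
    ... | inj₁ (refl , _) = ¬r (R-sym r)
    ... | inj₂ (refl , _) = ¬r (R-sym (r ◅◅ b⇝a))
    reps′ : Reps (S ⊕ e) (a ∷ b ∷ vs)
    reps′ =
      ( (bridge (∈-⊕ e) j ∷ All.map (_∘ R-mono (⊆-⊕ e)) far)
      ∷ All.map (λ ¬r r → ¬r (R-sym b⇝a ◅◅ R-mono (⊆-⊕ e) r)) far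
      ∷ AllPairs.map (_∘ R-mono (⊆-⊕ e)) sep )
      , λ w → cover′ w (cover w)
      where
      pick : ∀ {w x} → R (S ⊕ e) w x → x ≡ a ⊎ x ≡ b → Any (λ u → R (S ⊕ e) u w) (a ∷ b ∷ vs)
      pick r (inj₁ refl) = here (R-sym r)
      pick r (inj₂ refl) = there (here (R-sym r))
      cover′ : ∀ w → Any (λ u → R S u w) (a ∷ vs) → Any (λ u → R (S ⊕ e) u w) (a ∷ b ∷ vs)
      cover′ w (here a⇝w) with cross e a⇝w
      ... | inj₁ q = here q
      ... | inj₂ (x , y , j′ , _ , q) with Joins-ends j j′
      ...   | inj₁ (_ , refl) = there (here q)
      ...   | inj₂ (_ , refl) = here q
      cover′ w (there w∈) = there (there (go far w∈))
        where
        go : ∀ {us} → All (λ v → ¬ R S a v) us → Any (λ u → R S u w) us → Any (λ u → R (S ⊕ e) u w) us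
        go (¬r ∷ _)  (here r)   = here (avoids (far-⊕ (away ¬r)) r)
        go (_ ∷ ¬rs) (there r∈) = there (go ¬rs r∈)

  -- Induction on the number of removed edges: each further edge replaces one part by two with the
  -- same sum. The vertex `o` represents the only component when nothing is removed.
  sum-length-θ : Fin n → ∀ j S → ∣ S ∣ ≡ j → sum (θ G S) ≡ n × length (θ G S) ≡ suc j
  sum-length-θ o j S ∣S∣≡j with nonempty? S
  sum-length-θ o zero S ∣S∣≡j | yes (e , e∈S) =
    contradiction (trans (sym (∣⊕∣ (∉-remove S e))) (trans (cong ∣_∣ (remove-⊕ e∈S)) ∣S∣≡j)) λ ()
  sum-length-θ o (suc j) S ∣S∣≡j | yes (e , e∈S)
    with C , θS , θSe ← θ-split {S - e} {e} (∉-remove S e) (inj₁ refl)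
       | ih-sum , ih-length ← sum-length-θ o j (S - e)
           (suc-injective (trans (sym (∣⊕∣ (∉-remove S e))) (trans (cong ∣_∣ (remove-⊕ e∈S)) ∣S∣≡j)))
    rewrite remove-⊕ e∈S
    = trans (sum-↭ θSe) (trans (sym (+-assoc (sz S _) _ _)) (trans (sym (sum-↭ θS)) ih-sum))
    , trans (↭-length θSe) (cong suc (trans (sym (↭-length θS)) ih-length))
  sum-length-θ o j S ∣S∣≡j | no empty rewrite Empty-unique empty | sym ∣S∣≡j | ∣⊥∣≡0 m
    = trans (sum-↭ θ⊥) (trans (+-identityʳ _) whole) , ↭-length θ⊥
    where
    θ⊥ : θ G ⊥ ↭ sz ⊥ o ∷ []
    θ⊥ = θ-reps ([] ∷ [] , λ v → here (connected o v))
    whole : sz ⊥ o ≡ n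
    whole = trans (cong ∣_∣ (⊆-antisym ⊆⊤ (λ {v} _ → ∈-comp⁺ (connected o v)))) (∣⊤∣≡n n)

  -- Leaf edges of the remaining forest

  neighbour? : ∀ S u → (∀ v → R S u v → v ≡ u) ⊎ ∃₂ λ e w → e ∉ S × Joins (ends G e) u w
  neighbour? S u with Fin.any? (λ v → R? S u v ×-dec ¬? (v Fin.≟ u))
  ... | yes (v , ε , v≢u) = contradiction refl v≢u
  ... | yes (v , (e , e∉S , j) ◅ _ , _) = inj₂ (e , _ , e∉S , j)
  ... | no  none = inj₁ λ v r → decidable-stable (v Fin.≟ u) λ v≢u → none (v , r , v≢u)

  record Leaf (S : Subset m) (e : Fin m) (l : Fin n) : Set where
    constructor leaf
    field
      {stem} : Fin n
      kept   : e ∉ S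
      joins  : Joins (ends G e) stem l
      alone  : sz (S ⊕ e) l ≡ 1

  -- Walk away from `x`: either `y` is isolated beyond `e`, or another edge `g` leads on. The part
  -- beyond `g` is strictly smaller since it lacks `y`, so the walk ends.
  leaf-beyond : ∀ {S e x y} → e ∉ S → Joins (ends G e) x y → ∃₂ λ f l → Leaf S f l × R (S ⊕ e) y l
  leaf-beyond {S} e∉S j = go e∉S j (<-wellFounded _)
    where
    go : ∀ {e x y} → e ∉ S → Joins (ends G e) x y → Acc _<_ (sz (S ⊕ e) y) →
      ∃₂ λ f l → Leaf S f l × R (S ⊕ e) y l
    go {e} {x} {y} e∉S j (acc rec) with neighbour? (S ⊕ e) y
    ... | inj₁ alone = e , y , leaf e∉S j (isolated⇒sz≡1 alone) , ε
    ... | inj₂ (g , w , g∉ , j′) =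
      let f , l , lf , r = go g∉S j′ (rec (p⊂q⇒∣p∣<∣q∣
            ( (λ v∈ → ∈-comp⁺ (inside-comp (∈-comp⁻ (S ⊕ g) w v∈)))
            , y , ∈-comp⁺ {S ⊕ e} ε , λ y∈ → bridge (∈-⊕ g) (Joins-sym j′) (∈-comp⁻ (S ⊕ g) w y∈))))
      in f , l , lf , inside-comp r
      where
      g∉S : g ∉ S
      g∉S = g∉ ∘ ⊆-⊕ e
      y⇝w : R (S ⊕ e) y w
      y⇝w = edge g∉ j′
      widen : ∀ {u v} → R (S ⊕ g ⊕ e) u v → R (S ⊕ e) u v
      widen = R-mono (⊕-⊆ (⊆-⊕ e ∘ ⊆-⊕ g) (∈-⊕ e))
      -- A walk beyond `g` that met `e` would, at the end `x`, join the ends of `e` without `e`, and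
      -- at the end `y` those of `g` without `g`.
      inside-comp : ∀ {v} → R (S ⊕ g) w v → R (S ⊕ e) y v
      inside-comp r with cross e r
      ... | inj₁ q = y⇝w ◅◅ widen q
      ... | inj₂ (a , b , j″ , q , _) with Joins-ends j j″
      ...   | inj₁ (refl , _) = contradiction (y⇝w ◅◅ widen q) (bridge (∈-⊕ e) (Joins-sym j))
      ...   | inj₂ (refl , _) = contradiction (R-mono (⊆-⊕ e) q) (bridge (∈-⊕ g) (Joins-sym j′))

  -- Follow any edge `g` of the component in both directions. The leaves found lie on different
  -- sides of `g`, so they differ; if they share their edge, that edge is the whole component.
  two-leaves : ∀ {S u} → 2 ≤ sz S u → ∃₂ λ e l → ∃₂ λ f k →
    Leaf S e l × R S u l × Leaf S f k × R S u k × (e ≡ f → sz S u ≡ 2)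
  two-leaves {S} {u} 2≤ with neighbour? S u
  ... | inj₁ alone = contradiction (≤-trans 2≤ (≤-reflexive (isolated⇒sz≡1 alone))) 1+n≰n
  ... | inj₂ (g , w , g∉S , j)
    with e , l , lf , r ← leaf-beyond g∉S j
       | f , k , lf′ , r′ ← leaf-beyond g∉S (Joins-sym j)
    = e , l , f , k , lf , edge g∉S j ◅◅ R-mono (⊆-⊕ g) r , lf′ , R-mono (⊆-⊕ g) r′ , same lf lf′
    where
    l≢k : l ≢ k
    l≢k refl = bridge (∈-⊕ g) (Joins-sym j) (r ◅◅ R-sym r′)
    same : Leaf S e l → Leaf S f k → e ≡ f → sz S u ≡ 2
    same (leaf e∉ j₁ one) (leaf _ j₂ one′) refl with Joins-ends j₁ j₂
    ... | inj₁ (_ , refl) = contradiction refl l≢k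
    ... | inj₂ (refl , refl) = trans (sz-≡ {S} (R-mono (⊆-⊕ g) r′))
      (trans (sz-split e∉ j₁) (cong₂ _+_ one′ one))

  ∈-θ⁻ : ∀ {S x} → x ∈ˡ θ G S → ∃[ u ] x ≡ sz S u
  ∈-θ⁻ {S} x∈ with p , p∈ , refl ← ∈-map⁻ ∣_∣ x∈
    with u , _ , refl ← ∈-map⁻ (comp S) (∈-deduplicate⁻ _≟ˢ_ _ p∈) = u , refl

  θ-pos : ∀ {S x} → x ∈ˡ θ G S → 1 ≤ x
  θ-pos {S} x∈ with u , refl ← ∈-θ⁻ {S} x∈ = sz-pos S u

  -- Each edge forms a component with two vertices. If these components were the same, both edges
  -- would join the same two vertices.
  two-isolated-edges : ∀ {S e f} → e ∉ S → f ∉ S → e ≢ f →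
    (∀ {a b} → Joins (ends G e) a b → sz (S ⊕ e) a ≡ 1) →
    (∀ {a b} → Joins (ends G f) a b → sz (S ⊕ f) a ≡ 1) →
    2 ≤ occ 2 (θ G S)
  two-isolated-edges {S} {e} {f} e∉S f∉S e≢f one-e one-f =
    let C , θS = θ-separated {S} (a ∷ c ∷ []) ((¬r ∷ []) ∷ [] ∷ []) in
    ≤-trans (s≤s (s≤s z≤n)) (≤-reflexive (sym (trans (occ-resp-↭ 2 θS)
      (cong₂ (λ x y → δ 2 x + (δ 2 y + occ 2 C))
        (trans (sz-split e∉S je) (cong₂ _+_ (one-e je) (one-e (Joins-sym je))))
        (trans (sz-split f∉S jf) (cong₂ _+_ (one-f jf) (one-f (Joins-sym jf))))))))
    where
    a = proj₁ (ends G e)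
    b = proj₂ (ends G e)
    c = proj₁ (ends G f)
    d = proj₂ (ends G f)
    je : Joins (ends G e) a b
    je = inj₁ refl
    jf : Joins (ends G f) c d
    jf = inj₁ refl
    confined : ∀ {v} → R S a v → v ≡ a ⊎ v ≡ b
    confined r with cross e r
    ... | inj₁ q = inj₁ (sz≡1⇒isolated (one-e je) _ q)
    ... | inj₂ (x , y , j , _ , q) with Joins-ends je j
    ...   | inj₁ (_ , refl) = inj₂ (sz≡1⇒isolated (one-e (Joins-sym j)) _ q)
    ...   | inj₂ (_ , refl) = inj₁ (sz≡1⇒isolated (one-e (Joins-sym j)) _ q)
    joined : c ≡ a ⊎ c ≡ b → d ≡ a ⊎ d ≡ b → Joins (ends G f) c d → Joins (ends G f) a b
    joined (inj₁ p) (inj₂ q) j = subst₂ (Joins _) p q j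
    joined (inj₂ p) (inj₁ q) j = Joins-sym (subst₂ (Joins _) p q j)
    joined (inj₁ p) (inj₁ q) j = contradiction (subst (Joins _ c) (trans q (sym p)) j) loopless′
    joined (inj₂ p) (inj₂ q) j = contradiction (subst (Joins _ c) (trans q (sym p)) j) loopless′
    ¬r : ¬ R S a c
    ¬r r = e≢f (simple je (joined (confined r) (confined (r ◅◅ edge f∉S jf)) jf))

-- Descent by one edge

module Descent {n m : ℕ} (T T′ : Graph n m) (tree : IsTree T) (tree′ : IsTree T′)
  (S : Subset m) (small : ∣ S ∣ + 4 ≤ n)
  (agree : ∀ e → e ∉ S → θ T (S ⊕ e) ↭ θ T′ (S ⊕ e)) where

  -- This is all that the counting below uses of the removal of `e`; as `p` and `q` enter
  -- symmetrically, `flip` can exchange them.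
  record Split (G : Graph n m) (e : Fin m) (p q : ℕ) : Set where
    field
      kept   : e ∉ S
      rest   : List ℕ
      before : θ G S ↭ (p + q) ∷ rest
      after  : θ G (S ⊕ e) ↭ p ∷ q ∷ rest
      p-pos  : 1 ≤ p
      q-pos  : 1 ≤ q

  open Split

  flip : ∀ {G e p q} → Split G e p q → Split G e q p
  flip {p = p} {q} s = record
    { kept = kept s ; rest = rest s ; p-pos = q-pos s ; q-pos = p-pos s
    ; before = ↭-trans (before s) (↭-reflexive (cong (_∷ rest s) (+-comm p q)))
    ; after = ↭-trans (after s) (swap p q ↭-refl) }

  λs μs : List ℕ
  λs = θ T S
  μs = θ T′ S

  -- Before the removal, each partition is the common partition after it, less the two new parts,
  -- plus their sum. Moving the subtracted terms across keeps the identity in `ℕ`.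
  balance : ∀ {e p q p′ q′} → Split T e p q → Split T′ e p′ q′ → ∀ x →
    occ x λs + (δ x p + δ x q + δ x (p′ + q′)) ≡ occ x μs + (δ x p′ + δ x q′ + δ x (p + q))
  balance {e} {p} {q} {p′} {q′} s s′ x = begin
    occ x λs + (δ x p + δ x q + δ x (p′ + q′))
      ≡⟨ cong (_+ (δ x p + δ x q + δ x (p′ + q′))) (occ-resp-↭ x (before s)) ⟩
    δ x (p + q) + occ x (rest s) + (δ x p + δ x q + δ x (p′ + q′))
      ≡⟨ shuffle (δ x (p + q)) (occ x (rest s)) (δ x p) (δ x q) (δ x (p′ + q′)) ⟩
    δ x (p + q) + δ x (p′ + q′) + (δ x p + (δ x q + occ x (rest s)))
      ≡⟨ cong₂ _+_ (+-comm (δ x (p + q)) _) middle ⟩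
    δ x (p′ + q′) + δ x (p + q) + (δ x p′ + (δ x q′ + occ x (rest s′)))
      ≡⟨ shuffle (δ x (p′ + q′)) (occ x (rest s′)) (δ x p′) (δ x q′) (δ x (p + q)) ⟨
    δ x (p′ + q′) + occ x (rest s′) + (δ x p′ + δ x q′ + δ x (p + q))
      ≡⟨ cong (_+ (δ x p′ + δ x q′ + δ x (p + q))) (occ-resp-↭ x (before s′)) ⟨
    occ x μs + (δ x p′ + δ x q′ + δ x (p + q)) ∎
    where
    open ≡-Reasoning
    middle : δ x p + (δ x q + occ x (rest s)) ≡ δ x p′ + (δ x q′ + occ x (rest s′))
    middle = trans (sym (occ-resp-↭ x (after s))) (trans (occ-resp-↭ x (agree e (kept s))) (occ-resp-↭ x (after s′)))
    shuffle : ∀ a b c d e → a + b + (c + d + e) ≡ a + e + (c + (d + b))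
    shuffle = solve-∀

  module Splits (G : Graph n m) (tree : IsTree G) where
    open Tree G tree

    split : ∀ {e a b} → e ∉ S → Joins (ends G e) a b → Split G e (sz (S ⊕ e) a) (sz (S ⊕ e) b)
    split e∉S j = let C , before , after = θ-split e∉S j in record
      { kept = e∉S ; rest = C ; before = before ; after = after
      ; p-pos = sz-pos (S ⊕ _) _ ; q-pos = sz-pos (S ⊕ _) _ }

    some-split : ∀ {e} → e ∉ S → ∃₂ (Split G e)
    some-split e∉S = _ , _ , split e∉S (inj₁ refl)

    leaf-split : ∀ {e l x} → Leaf S e l → x ≡ sz S l → Split G e 1 (x ∸ 1)
    leaf-split {e} {l} (leaf {stem} e∉S j one) refl =
      subst₂ (Split G e) one
        (sym (trans (cong (_∸ 1) (trans (sz-split e∉S (Joins-sym j)) (cong (_+ sz (S ⊕ e) stem) one))) refl))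
        (split e∉S (Joins-sym j))

    leaf-splits : ∀ {x} → x ∈ˡ θ G S → 2 ≤ x →
      ∃₂ λ e f → Split G e 1 (x ∸ 1) × Split G f 1 (x ∸ 1) × (e ≡ f → x ≡ 2)
    leaf-splits x∈ 2≤x with u , refl ← ∈-θ⁻ {S} x∈
      with e , l , f , k , lf , r , lf′ , r′ , same ← two-leaves 2≤x
      = e , f , leaf-split lf (sz-≡ {S} r) , leaf-split lf′ (sz-≡ {S} r′) , same

  module T  = Splits T tree
  module T′ = Splits T′ tree′

  -- `v` is the largest part on which the partitions disagree, with the surplus in `T`. A
  -- contradiction follows in `no-excess`.
  module _ (v : ℕ) (excess : occ v μs < occ v λs) (above : AgreeAbove v λs μs) where

    v∈λs : v ∈ˡ λs
    v∈λs = occ⇒∈ λs (>⇒≢ (≤-<-trans z≤n excess))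

    balance-above : ∀ {e p q p′ q′} → Split T e p q → Split T′ e p′ q′ → ∀ {x} → v < x →
      δ x p + δ x q + δ x (p′ + q′) ≡ δ x p′ + δ x q′ + δ x (p + q)
    balance-above {p = p} {q} {p′} {q′} s s′ {x} v<x = +-cancelˡ-≡ (occ x μs) _ _
      (trans (cong (_+ (δ x p + δ x q + δ x (p′ + q′))) (sym (above x v<x))) (balance s s′ x))

    -- The number `v + q′` exceeds `v`, so the multiplicities before the removal agree there. The
    -- part of this size lost in `T′` is too large to be one of the new parts in `T′`, so `T` loses
    -- such a part as well.
    v-part-whole : ∀ {e p q q′} → Split T e p q → Split T′ e v q′ → v + q′ ≡ p + q
    v-part-whole {p = p} {q} {q′} s s′ = decidable-stable (v + q′ ≟ p + q) λ neq → 1+n≢0 (begin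
      suc (δ z p + δ z q)             ≡⟨ +-comm 1 _ ⟩
      δ z p + δ z q + 1               ≡⟨ cong (δ z p + δ z q +_) (δ-refl z) ⟨
      δ z p + δ z q + δ z z           ≡⟨ balance-above s s′ big ⟩
      δ z v + δ z q′ + δ z (p + q)    ≡⟨ cong₂ _+_ (cong₂ _+_ (δ-≢ (>⇒≢ big))
                                          (δ-≢ (>⇒≢ (m<n+m q′ (p-pos s′))))) (δ-≢ neq) ⟩
      0 ∎)
      where
      open ≡-Reasoning
      z = v + q′
      big : v < z
      big = m<m+n v (q-pos s′)

    -- The removal must cancel the surplus of `v`: either `T` loses a part `v` or `T′` gains one.
    v-covered : ∀ {e p q p′ q′} → Split T e p q → Split T′ e p′ q′ → p + q ≢ v → p′ ≡ v ⊎ q′ ≡ v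
    v-covered {p = p} {q} {p′} {q′} s s′ ≢v with p′ ≟ v | q′ ≟ v
    ... | yes eq | _ = inj₁ eq
    ... | no _ | yes eq = inj₂ eq
    ... | no p′≢v | no q′≢v = contradiction excess (≤⇒≯ (begin
      occ v λs ≤⟨ m≤m+n _ _ ⟩
      occ v λs + (δ v p + δ v q + δ v (p′ + q′)) ≡⟨ balance s s′ v ⟩
      occ v μs + (δ v p′ + δ v q′ + δ v (p + q)) ≡⟨ cong (occ v μs +_)
        (cong₂ _+_ (cong₂ _+_ (δ-≢ (p′≢v ∘ sym)) (δ-≢ (q′≢v ∘ sym))) (δ-≢ (≢v ∘ sym))) ⟩
      occ v μs + 0 ≡⟨ +-identityʳ _ ⟩
      occ v μs ∎))
      where open ≤-Reasoning

    -- If a part x > v were split as 1 + (x ∸ 1) in T and as v + q′ in T′, then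
    -- the new part x ∸ 1 ≥ v would have to occur on the other side as well.
    no-larger-part : ∀ {e x q′} → v < x → Split T e 1 (x ∸ 1) → Split T′ e v q′ → Empty.⊥
    no-larger-part {x = suc x} {q′} (s≤s v≤x) s s′ =
      case m≤n⇒m<n∨m≡n v≤x of λ
      { (inj₂ refl) → coincide (inj₁ refl)
      ; (inj₁ v<x)  → case x ≟ q′ of λ
        { (yes refl) → coincide (inj₂ refl)
        ; (no x≢q′)  → 1+n≢0 (begin
            suc (δ x 1 + δ x (v + q′))            ≡⟨ +-comm 1 _ ⟩
            δ x 1 + δ x (v + q′) + 1              ≡⟨ cong (δ x 1 + δ x (v + q′) +_) (δ-refl x) ⟨
            δ x 1 + δ x (v + q′) + δ x x          ≡⟨ swap-last (δ x 1) _ _ ⟩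
            δ x 1 + δ x x + δ x (v + q′)          ≡⟨ balance-above s s′ v<x ⟩
            δ x v + δ x q′ + δ x (suc x)          ≡⟨ cong₂ _+_ (cong₂ _+_ (δ-≢ (>⇒≢ v<x)) (δ-≢ x≢q′))
                                                       (δ-≢ (<⇒≢ (n<1+n x))) ⟩
            0 ∎) } }
      where
      open ≡-Reasoning
      swap-last : ∀ a b c → a + b + c ≡ a + c + b
      swap-last = solve-∀
      whole : v + q′ ≡ suc x
      whole = v-part-whole s s′
      same-parts : v ≡ x ⊎ q′ ≡ x → ∀ y → δ y 1 + δ y x ≡ δ y v + δ y q′
      same-parts (inj₁ refl) y = trans (+-comm (δ y 1) (δ y x))
        (cong (λ z → δ y x + δ y z) (+-cancelˡ-≡ x _ _ (trans (+-comm x 1) (sym whole))))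
      same-parts (inj₂ refl) y =
        cong (λ z → δ y z + δ y q′) (+-cancelʳ-≡ q′ _ _ (sym whole))
      -- Here both trees split equal wholes into equal parts, so the multiplicities of `v` were
      -- equal before, against `excess`.
      coincide : v ≡ x ⊎ x ≡ q′ → Empty.⊥
      coincide c = <-irrefl (sym (+-cancelʳ-≡ parts (occ v λs) (occ v μs) (trans (balance s s′ v)
        (cong (occ v μs +_) (cong₂ _+_ (sym (same-parts ([ inj₁ , inj₂ ∘ sym ]′ c) v)) (cong (δ v) (sym whole))))))) excess
        where parts = δ v 1 + δ v x + δ v (v + q′)

    -- If `x` is not `v`, then removing a leaf edge inside `x` creates a part `v` in `T′`. By
    -- `v-part-whole` this makes `x` larger than `v`, which `no-larger-part` excludes.
    large-part : ∀ {x} → x ∈ˡ λs → 2 ≤ x → x ≡ v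
    large-part {x} x∈ 2≤x with e , _ , s , _ ← T.leaf-splits x∈ 2≤x
      with p′ , q′ , s′ ← T′.some-split (kept s)
      = decidable-stable (x ≟ v) λ x≢v → case v-covered s s′ (x≢v ∘ trans (sym x≡)) of λ
        { (inj₁ refl) → no-larger-part (bigger (v-part-whole s s′) (q-pos s′)) s s′
        ; (inj₂ refl) → no-larger-part (bigger (v-part-whole s (flip s′)) (p-pos s′)) s (flip s′) }
      where
      x≡ : 1 + (x ∸ 1) ≡ x
      x≡ = m+[n∸m]≡n (≤-trans (s≤s z≤n) 2≤x)
      bigger : ∀ {q} → v + q ≡ 1 + (x ∸ 1) → 1 ≤ q → v < x
      bigger {q} eq 1≤q = ≤-trans (m<m+n v 1≤q) (≤-reflexive (trans eq x≡))

    vertex : Fin n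
    vertex = proj₁ (Tree.∈-θ⁻ T tree {S} v∈λs)

    -- Otherwise all parts of `λs` are 1 by `large-part`, so n = |S| + 1, against `small`.
    2≤v : 2 ≤ v
    2≤v = ≰⇒> λ v≤1 → <-irrefl (sym (trans (sym sum-λs) (trans (ones (All.tabulate (one v≤1))) length-λs)))
      (≤-trans (≤-trans (≤-reflexive (+-comm 2 ∣ S ∣)) (+-monoʳ-≤ ∣ S ∣ (s≤s (s≤s z≤n)))) small)
      where
      sum-λs = proj₁ (Tree.sum-length-θ T tree vertex ∣ S ∣ S refl)
      length-λs = proj₂ (Tree.sum-length-θ T tree vertex ∣ S ∣ S refl)
      one : v ≤ 1 → ∀ {x} → x ∈ˡ λs → x ≡ 1
      one v≤1 {x} x∈ = ≤-antisym
        (≮⇒≥ λ 2≤x → <-irrefl (sym (large-part x∈ 2≤x)) (≤-<-trans v≤1 2≤x))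
        (Tree.θ-pos T tree {S} x∈)
      ones : ∀ {xs} → All (_≡ 1) xs → sum xs ≡ length xs
      ones []            = refl
      ones (refl ∷ all1) = cong suc (ones all1)

    1+v∸1 : 1 + (v ∸ 1) ≡ v
    1+v∸1 = m+[n∸m]≡n (≤-trans (s≤s z≤n) 2≤v)

    v∸1<v : v ∸ 1 < v
    v∸1<v = ≤-reflexive 1+v∸1

    δ-v-leaf : δ v 1 + δ v (v ∸ 1) ≡ 0
    δ-v-leaf = cong₂ _+_ (δ-≢ (>⇒≢ 2≤v)) (δ-≢ (>⇒≢ v∸1<v))

    -- Take a leaf edge inside a part `v` of `T′`. In `T` it also splits a part `v`, by
    -- `large-part`. Both trees lose one `v` and gain none, so there was no surplus.
    v∉μs : occ v μs ≡ 0
    v∉μs = decidable-stable (occ v μs ≟ 0) λ nz →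
      let e , _ , s′ , _ = T′.leaf-splits (occ⇒∈ μs nz) 2≤v
          p , q , s = T.some-split (kept s′)
          p+q≡v = large-part (∈-resp-↭ (↭-sym (before s)) (here refl)) (+-mono-≤ (p-pos s) (q-pos s))
          p<v = ≤-trans (m<m+n p (q-pos s)) (≤-reflexive p+q≡v)
          q<v = ≤-trans (m<n+m q (p-pos s)) (≤-reflexive p+q≡v)
      in <-irrefl (sym (+-cancelʳ-≡ 1 (occ v λs) (occ v μs) (begin
        occ v λs + 1 ≡⟨ cong (occ v λs +_) (cong₂ _+_ (cong₂ _+_ (δ-≢ (>⇒≢ p<v)) (δ-≢ (>⇒≢ q<v)))
                          (trans (cong (δ v) 1+v∸1) (δ-refl v))) ⟨
        occ v λs + (δ v p + δ v q + δ v (1 + (v ∸ 1))) ≡⟨ balance s s′ v ⟩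
        occ v μs + (δ v 1 + δ v (v ∸ 1) + δ v (p + q)) ≡⟨ cong (occ v μs +_) (cong₂ _+_ δ-v-leaf
                          (trans (cong (δ v) p+q≡v) (δ-refl v))) ⟩
        occ v μs + 1 ∎))) excess
      where open ≡-Reasoning

    v-not-a-part : ∀ {e q′} → Split T e 1 (v ∸ 1) → ¬ Split T′ e v q′
    v-not-a-part s s′ = <-irrefl (sym (trans (v-part-whole s s′) 1+v∸1)) (m<m+n v (q-pos s′))

    -- In `balance` at `v`, the only term left on the side of `μs` is the whole `v` that `T` splits.
    occ-v-balance : ∀ {e p′ q′} → Split T e 1 (v ∸ 1) → Split T′ e p′ q′ → occ v λs + δ v (p′ + q′) ≡ 1
    occ-v-balance {p′ = p′} {q′} s s′ = begin
      occ v λs + δ v (p′ + q′)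
        ≡⟨ cong (λ d → occ v λs + (d + δ v (p′ + q′))) δ-v-leaf ⟨
      occ v λs + (δ v 1 + δ v (v ∸ 1) + δ v (p′ + q′))
        ≡⟨ balance s s′ v ⟩
      occ v μs + (δ v p′ + δ v q′ + δ v (1 + (v ∸ 1)))
        ≡⟨ cong₂ _+_ v∉μs (cong₂ _+_ (cong₂ _+_
             (δ-≢ {v} {p′} λ { refl → v-not-a-part s s′ }) (δ-≢ {v} {q′} λ { refl → v-not-a-part s (flip s′) }))
             (trans (cong (δ v) 1+v∸1) (δ-refl v))) ⟩
      1 ∎
      where open ≡-Reasoning

    occ-v≡1 : occ v λs ≡ 1
    occ-v≡1 with _ , _ , s , _ ← T.leaf-splits v∈λs 2≤v with _ , _ , s′ ← T′.some-split (kept s)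
      = ≤-antisym (≤-trans (m≤m+n _ _) (≤-reflexive (occ-v-balance s s′))) (∈⇒occ v∈λs)

    -- Among the |S| + 1 parts of `λs` one is `v` and the others are 1, so n = |S| + v; `small` then
    -- gives the bound.
    4≤v : 4 ≤ v
    4≤v = +-cancelˡ-≤ ∣ S ∣ 4 v (≤-trans small (≤-reflexive (begin
      n                                       ≡⟨ proj₁ (Tree.sum-length-θ T tree vertex ∣ S ∣ S refl) ⟨
      sum λs                                  ≡⟨ sum-parts (All.tabulate parts) ⟩
      length λs + occ v λs * (v ∸ 1)          ≡⟨ cong₂ (λ l c → l + c * (v ∸ 1))
                                                   (proj₂ (Tree.sum-length-θ T tree vertex ∣ S ∣ S refl)) occ-v≡1 ⟩
      suc ∣ S ∣ + (v ∸ 1 + 0)                  ≡⟨ cong (suc ∣ S ∣ +_) (+-identityʳ _) ⟩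
      suc ∣ S ∣ + (v ∸ 1)                      ≡⟨ +-suc ∣ S ∣ (v ∸ 1) ⟨
      ∣ S ∣ + suc (v ∸ 1)                      ≡⟨ cong (∣ S ∣ +_) 1+v∸1 ⟩
      ∣ S ∣ + v ∎)))
      where
      open ≡-Reasoning
      parts : ∀ {x} → x ∈ˡ λs → x ≡ 1 ⊎ x ≡ v
      parts {x} x∈ with 2 ≤? x
      ... | yes 2≤x = inj₂ (large-part x∈ 2≤x)
      ... | no  2≰x = inj₁ (≤-antisym (≮⇒≥ 2≰x) (Tree.θ-pos T tree {S} x∈))
      regroup₂ : ∀ w l c → suc w + (l + c * w) ≡ suc l + (w + c * w)
      regroup₂ = solve-∀
      sum-parts : ∀ {xs} → All (λ x → x ≡ 1 ⊎ x ≡ v) xs → sum xs ≡ length xs + occ v xs * (v ∸ 1)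
      sum-parts [] = refl
      sum-parts {_ ∷ xs} (inj₁ refl ∷ ps) rewrite δ-≢ (>⇒≢ 2≤v) = cong suc (sum-parts ps)
      sum-parts {_ ∷ xs} (inj₂ refl ∷ ps) rewrite δ-refl v = begin
        v + sum xs                                   ≡⟨ cong₂ _+_ (sym 1+v∸1) (sum-parts ps) ⟩
        suc (v ∸ 1) + (length xs + occ v xs * (v ∸ 1)) ≡⟨ regroup₂ (v ∸ 1) (length xs) (occ v xs) ⟩
        suc (length xs) + (v ∸ 1 + occ v xs * (v ∸ 1)) ∎

    absent : ∀ {x} → 2 ≤ x → x ≢ v → occ x λs ≡ 0
    absent {x} 2≤x x≢v = decidable-stable (occ x λs ≟ 0) λ nz → x≢v (large-part (occ⇒∈ λs nz) 2≤x)

    -- The multiplicity of `p′` in `λs` is 0, since `p′` is neither 1 nor `v`. So the parts equal to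
    -- `p′` that `T′` creates must be matched by the single part `v ∸ 1`.
    new-part : ∀ {e p′ q′} → Split T e 1 (v ∸ 1) → Split T′ e p′ q′ → 2 ≤ p′ → p′ ≡ v ∸ 1 × q′ ≢ p′
    new-part {p′ = p′} {q′} s s′ 2≤p′ = p′≡ , λ q′≡p′ → 1+n≰n (begin
        2                                                  ≡⟨ cong₂ _+_ (δ-refl p′) (trans (cong (δ p′) q′≡p′) (δ-refl p′)) ⟨
        δ p′ p′ + δ p′ q′                                  ≤⟨ at-p′ ⟩
        δ p′ (v ∸ 1)                                       ≡⟨ trans (cong (δ p′) (sym p′≡)) (δ-refl p′) ⟩
        1                                                  ∎)
      where
      open ≤-Reasoning
      at-p′ : δ p′ p′ + δ p′ q′ ≤ δ p′ (v ∸ 1)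
      at-p′ = begin
        δ p′ p′ + δ p′ q′                                  ≤⟨ m≤m+n _ _ ⟩
        δ p′ p′ + δ p′ q′ + δ p′ (1 + (v ∸ 1))             ≤⟨ m≤n+m _ (occ p′ μs) ⟩
        occ p′ μs + (δ p′ p′ + δ p′ q′ + δ p′ (1 + (v ∸ 1))) ≡⟨ balance s s′ p′ ⟨
        occ p′ λs + (δ p′ 1 + δ p′ (v ∸ 1) + δ p′ (p′ + q′)) ≡⟨ cong₂ _+_
          (absent 2≤p′ λ { refl → v-not-a-part s s′ })
          (cong₂ _+_ (cong (_+ δ p′ (v ∸ 1)) (δ-≢ (>⇒≢ 2≤p′))) (δ-≢ (<⇒≢ (m<m+n p′ (q-pos s′))))) ⟩
        δ p′ (v ∸ 1) + 0                                   ≡⟨ +-identityʳ _ ⟩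
        δ p′ (v ∸ 1)                                       ∎
      p′≡ : p′ ≡ v ∸ 1
      p′≡ = decidable-stable (p′ ≟ v ∸ 1) λ neq → 1+n≰n (begin
        1                                                  ≡⟨ δ-refl p′ ⟨
        δ p′ p′                                            ≤⟨ m≤m+n _ _ ⟩
        δ p′ p′ + δ p′ q′                                  ≤⟨ at-p′ ⟩
        δ p′ (v ∸ 1)                                       ≡⟨ δ-≢ neq ⟩
        0                                                  ∎)

    -- If `p′` is at least 2, it is `v ∸ 1`. Then `q′` is not at least 2, as it would be `v ∸ 1`
    -- too; and `q′` = 1 gives `p′ + q′` = `v`, so that `occ-v-balance` reads 1 + 1 = 1.
    leaf⇒isolated : ∀ {e p′ q′} → Split T e 1 (v ∸ 1) → Split T′ e p′ q′ → p′ ≡ 1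
    leaf⇒isolated {e} {p′} {q′} s s′ = ≤-antisym (≮⇒≥ λ 2≤p′ → absurd 2≤p′ (2 ≤? q′)) (p-pos s′)
      where
      absurd : 2 ≤ p′ → ¬ Dec (2 ≤ q′)
      absurd 2≤p′ (yes 2≤q′) =
        proj₂ (new-part s s′ 2≤p′) (trans (proj₁ (new-part s (flip s′) 2≤q′)) (sym (proj₁ (new-part s s′ 2≤p′))))
      absurd 2≤p′ (no 2≰q′) = 1+n≢0 (suc-injective (begin
        2                          ≡⟨ cong₂ _+_ occ-v≡1 (trans (cong (δ v) v≡) (δ-refl v)) ⟨
        occ v λs + δ v (p′ + q′)   ≡⟨ occ-v-balance s s′ ⟩
        1                          ∎))
        where
        open ≡-Reasoning
        v≡ : p′ + q′ ≡ v
        v≡ = trans (cong₂ _+_ (proj₁ (new-part s s′ 2≤p′)) (≤-antisym (≮⇒≥ 2≰q′) (q-pos s′)))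
          (trans (+-comm (v ∸ 1) 1) 1+v∸1)

    -- Two leaf edges of `T` inside the part `v` differ because `v` is not 2. Both are isolated
    -- edges in `T′`, which requires two parts 2 in `μs`.
    no-excess : Empty.⊥
    no-excess with e , f , s , t , same ← T.leaf-splits v∈λs 2≤v = 1+n≰n (≤-trans
      (Tree.two-isolated-edges T′ tree′ (kept s) (kept t)
        (λ e≡f → <-irrefl (sym (same e≡f)) (≤-trans (s≤s (s≤s (s≤s z≤n))) 4≤v))
        (λ j → leaf⇒isolated s (T′.split (kept s) j))
        (λ j → leaf⇒isolated t (T′.split (kept t) j)))
      (≤-reflexive (occ-2 s (both s (T′.split (kept s) (inj₁ refl))))))
      where
      open ≡-Reasoning
      2≢v : 2 ≢ v
      2≢v refl = case 4≤v of λ { (s≤s (s≤s ())) }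
      2≢v∸1 : 2 ≢ v ∸ 1
      2≢v∸1 eq = <-irrefl (trans (cong suc eq) 1+v∸1) 4≤v
      both : ∀ {e p′ q′} → Split T e 1 (v ∸ 1) → Split T′ e p′ q′ → Split T′ e 1 1
      both s s′ = subst₂ (Split T′ _) (leaf⇒isolated s s′) (leaf⇒isolated s (flip s′)) s′
      -- `balance` at 2 leaves only the split 2 = 1 + 1, because neither `v` nor `v ∸ 1` is 2; this
      -- uses 4 ≤ `v`.
      occ-2 : ∀ {e} → Split T e 1 (v ∸ 1) → Split T′ e 1 1 → occ 2 μs ≡ 1
      occ-2 s s′ = begin
        occ 2 μs                                             ≡⟨ +-identityʳ _ ⟨
        occ 2 μs + 0                                         ≡⟨ cong (occ 2 μs +_) (δ-≢ (2≢v ∘ (λ eq → trans eq 1+v∸1))) ⟨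
        occ 2 μs + (δ 2 1 + δ 2 1 + δ 2 (1 + (v ∸ 1)))       ≡⟨ balance s s′ 2 ⟨
        occ 2 λs + (δ 2 1 + δ 2 (v ∸ 1) + δ 2 (1 + 1))       ≡⟨ cong₂ (λ c d → c + (d + 1))
                                                                 (absent ≤-refl 2≢v) (δ-≢ 2≢v∸1) ⟩
        1                                                    ∎

descend : ∀ {n m} (T T′ : Graph n m) → IsTree T → IsTree T′ → (S : Subset m) → ∣ S ∣ + 4 ≤ n →
  (∀ e → e ∉ S → θ T (S ⊕ e) ↭ θ T′ (S ⊕ e)) → θ T S ↭ θ T′ S
descend T T′ tree tree′ S small agree with ↭-or-largest-difference (θ T S) (θ T′ S)
... | inj₁ eq = eq
... | inj₂ (v , ≢v , above) with <-cmp (occ v (θ T′ S)) (occ v (θ T S))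
...   | tri< lt _ _ = contradiction above (Descent.no-excess T T′ tree tree′ S small agree v lt)
...   | tri≈ _ eq _ = contradiction (sym eq) ≢v
...   | tri> _ _ gt = contradiction (λ x v<x → sym (above x v<x))
        (Descent.no-excess T′ T tree′ tree S small (λ e e∉S → ↭-sym (agree e e∉S)) v gt)

Agree : Graph n m → Graph n m → ℕ → Set
Agree {m = m} T T′ j = (S : Subset m) → ∣ S ∣ ≡ j → θ T S ↭ θ T′ S

-- One use of `descend` per level: at sets of size `d + j` it needs d + j + 4 ≤ n, which is the
-- bound for `suc d`.
agree-below : (T T′ : Graph n m) → IsTree T → IsTree T′ →
  ∀ d {j} → d + j + 3 ≤ n → Agree T T′ (d + j) → Agree T T′ j
agree-below T T′ tree tree′ zero    _     agree = agree
agree-below {n} T T′ tree tree′ (suc d) {j} small agree =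
  agree-below T T′ tree tree′ d (≤-trans (n≤1+n _) small) λ S ∣S∣≡ →
    descend T T′ tree tree′ S (≤-trans (≤-reflexive (trans (cong (_+ 4) ∣S∣≡) (+-suc (d + j) 3))) small)
      λ e e∉S → agree (S ⊕ e) (trans (∣⊕∣ e∉S) (cong suc ∣S∣≡))

-- Rooted trees and the order on their edges

module Rooted {n m : ℕ} (G : Graph n m) (tree : IsTree G) (r : Fin n) where
  open Tree G tree

  θ-sum : ∀ {S xs} → θ G S ↭ xs → sum xs ≡ n
  θ-sum {S} θS = trans (sym (sum-↭ θS)) (proj₁ (sum-length-θ r ∣ S ∣ S refl))

  -- Since there are |S| + 1 parts, that many separated vertices already represent all components.
  θ-complete : ∀ {S} us → Separated S us → length us ≡ suc ∣ S ∣ → θ G S ↭ map (sz S) us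
  θ-complete {S} us sep len with θ-separated us sep
  ... | [] , θS = ↭-trans θS (↭-reflexive (++-identityʳ _))
  ... | c ∷ C , θS = contradiction
    (trans (sym (proj₂ (sum-length-θ r ∣ S ∣ S refl)))
      (trans (↭-length θS) (trans (length-++ (map (sz S) us)) (cong (_+ _) (trans (length-map (sz S) us) len)))))
    (<⇒≢ (m<m+n (suc ∣ S ∣) (s≤s z≤n)))

  θ-all-but-one : ∀ {S} us → Separated S us → length us ≡ ∣ S ∣ → ∃[ t ] θ G S ↭ map (sz S) us ++ [ t ]
  θ-all-but-one {S} us sep len
    with C , θS ← θ-separated us sep
    with C | θS | +-cancelˡ-≡ ∣ S ∣ _ _ (trans (cong (_+ length C) (trans (sym len) (sym (length-map (sz S) us))))
      (trans (sym (length-++ (map (sz S) us))) (trans (sym (↭-length θS))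
      (trans (proj₂ (sum-length-θ r ∣ S ∣ S refl)) (+-comm 1 ∣ S ∣)))))
  ... | t ∷ [] | θS | refl = t , θS

  -- `e` separates `v` from the root. Being the negation of a decidable relation, this can be proved
  -- by contradiction.
  Below : Fin m → Fin n → Set
  Below e v = ¬ R (⊥ ⊕ e) r v

  -- The upper end of `e` is the one that a walk from the root reaches without crossing `e`.
  orient : ∀ e → ∃₂ λ x y → Joins (ends G e) x y × R (⊥ ⊕ e) r x
  orient e with cross e (connected r (proj₁ (ends G e)))
  ... | inj₁ q                   = _ , _ , inj₁ refl , q
  ... | inj₂ (x , y , j , q , _) = x , y , j , q

  top child : Fin m → Fin n
  top e = proj₁ (orient e)
  child e = proj₁ (proj₂ (orient e))

  joins : ∀ e → Joins (ends G e) (top e) (child e)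
  joins e = proj₁ (proj₂ (proj₂ (orient e)))

  r⇝top : ∀ e → R (⊥ ⊕ e) r (top e)
  r⇝top e = proj₂ (proj₂ (proj₂ (orient e)))

  child-below : ∀ e → Below e (child e)
  child-below e q = bridge (∈-⊕ e) (joins e) (R-sym (r⇝top e) ◅◅ q)

  below⇒R : ∀ {e v} → Below e v → R (⊥ ⊕ e) (child e) v
  below⇒R {e} {v} below with cross e (connected r v)
  ... | inj₁ q = contradiction q below
  ... | inj₂ (x , y , j , q , q′) with Joins-ends (joins e) j
  ...   | inj₁ (refl , refl) = q′
  ...   | inj₂ (refl , refl) = contradiction q (child-below e)

  R⇒below : ∀ {e v} → R (⊥ ⊕ e) (child e) v → Below e v
  R⇒below {e} q q′ = child-below e (q′ ◅◅ R-sym q)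

  ¬below⇒R : ∀ {e v} → ¬ Below e v → R (⊥ ⊕ e) r v
  ¬below⇒R {e} {v} = decidable-stable (R? (⊥ ⊕ e) r v)

  ⊥⊕-⊆ : ∀ {e} {S : Subset m} → e ∈ S → ⊥ ⊕ e ⊆ S
  ⊥⊕-⊆ = ⊕-⊆ {S = ⊥} λ z → contradiction z ∉⊥

  infix 4 _⊒_
  _⊒_ : Fin m → Fin m → Set
  e ⊒ f = Below e (child f)

  end⇝child : ∀ {e f x y} → f ≢ e → Joins (ends G f) x y → R (⊥ ⊕ e) x (child f)
  end⇝child {f = f} f≢e j with Joins-ends (joins f) j
  ... | inj₁ (refl , _) = edge (∉-⊕ ∉⊥ f≢e) (joins f)
  ... | inj₂ (refl , _) = ε

  -- The walk from the root to `top e` avoids `e` and has to cross `f`, since otherwise `child e`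
  -- would be reached without `f`. Its initial stretch leads to `f` on the root side of `e`.
  above-ends : ∀ {e f x y} → f ≢ e → f ⊒ e → Joins (ends G f) x y → R (⊥ ⊕ e) r x
  above-ends {e} {f} f≢e f⊒e j with cross f (r⇝top e)
  ... | inj₁ q = contradiction
    (R-mono (⊥⊕-⊆ (∈-⊕ {S = ⊥ ⊕ e} f)) q ◅◅ edge (∉-⊕ ∉⊥ (f≢e ∘ sym)) (joins e)) f⊒e
  ... | inj₂ (_ , _ , j′ , q , _) =
    R-mono (⊆-⊕ f) q ◅◅ end⇝child f≢e j′ ◅◅ R-sym (end⇝child f≢e j)

  ⊒-asym : ∀ {e f} → f ≢ e → f ⊒ e → ¬ e ⊒ f
  ⊒-asym f≢e f⊒e e⊒f = e⊒f (above-ends f≢e f⊒e (Joins-sym (joins _)))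

  lower upper : Fin m → ℕ
  lower e = sz (⊥ ⊕ e) (child e)
  upper e = sz (⊥ ⊕ e) r

  -- All that is below `e` is below `f`, and `child f` is below `f` only. So the sizes tell which of
  -- two comparable edges is the upper one.
  ⊒⇒lower< : ∀ {e f} → f ≢ e → f ⊒ e → lower e < lower f
  ⊒⇒lower< {e} {f} f≢e f⊒e = p⊂q⇒∣p∣<∣q∣
    ( (λ {v} v∈ → ∈-comp⁺ (below⇒R {f} {v} (λ q → f⊒e (q ◅◅ R-sym (within (∈-comp⁻ (⊥ ⊕ e) (child e) v∈))))))
    , child f , ∈-comp⁺ {⊥ ⊕ f} ε
    , λ v∈ → R⇒below (∈-comp⁻ (⊥ ⊕ e) (child e) v∈) (above-ends f≢e f⊒e (Joins-sym (joins f))) )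
    where
    within : ∀ {v} → R (⊥ ⊕ e) (child e) v → R (⊥ ⊕ f) (child e) v
    within q = R-mono (⊥⊕-⊆ (∈-⊕ {S = ⊥ ⊕ e} f))
      (avoids (far-⊕ λ j q′ → R⇒below q′ (above-ends f≢e f⊒e j)) q)

  ∉⊥⊕⇒≢ : ∀ {e g : Fin m} → g ∉ ⊥ {m} ⊕ e → g ≢ e
  ∉⊥⊕⇒≢ {e} g∉ refl = g∉ (∈-⊕ {S = ⊥} e)

  -- The other removed edges all lie outside the part below `e`.
  sz-child : ∀ {S e} → e ∈ S → (∀ {g} → g ∈ S → g ≢ e → ¬ e ⊒ g) → sz S (child e) ≡ lower e
  sz-child {S} {e} e∈S ¬⊒ = sz-stable {⊥ ⊕ e} {S} (⊥⊕-⊆ e∈S) λ g∈ g∉ j q →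
    ¬⊒ g∈ (∉⊥⊕⇒≢ g∉) (R⇒below (q ◅◅ end⇝child (∉⊥⊕⇒≢ g∉) j))

  sz-root : ∀ {S e} → e ∈ S → (∀ {g} → g ∈ S → g ≢ e → e ⊒ g) → sz S r ≡ upper e
  sz-root {S} {e} e∈S ⊒g = sz-stable {⊥ ⊕ e} {S} (⊥⊕-⊆ e∈S) λ g∈ g∉ j q →
    ⊒g g∈ (∉⊥⊕⇒≢ g∉) (q ◅◅ end⇝child (∉⊥⊕⇒≢ g∉) j)

  root-child : ∀ {S e} → e ∈ S → ¬ R S r (child e)
  root-child {e = e} e∈S q = child-below e (R-mono (⊥⊕-⊆ e∈S) q)

  child-child : ∀ {S e f} → e ∈ S → ¬ e ⊒ f → ¬ R S (child e) (child f)
  child-child e∈S ¬⊒ q = ¬⊒ (R⇒below (R-mono (⊥⊕-⊆ e∈S) q))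


  ∈⊥⊕ : ∀ {e g : Fin m} → g ∈ ⊥ {m} ⊕ e → g ≡ e
  ∈⊥⊕ g∈ with ∈-⊕⁻ {S = ⊥} g∈
  ... | inj₁ g∈⊥ = contradiction g∈⊥ ∉⊥
  ... | inj₂ g≡e = g≡e

  ∈⊥⊕⊕ : ∀ {e f g : Fin m} → g ∈ ⊥ {m} ⊕ e ⊕ f → g ≡ e ⊎ g ≡ f
  ∈⊥⊕⊕ {e} g∈ with ∈-⊕⁻ {S = ⊥ ⊕ e} g∈
  ... | inj₁ g∈e = inj₁ (∈⊥⊕ g∈e)
  ... | inj₂ g≡f = inj₂ g≡f

  ∈⊥⊕⊕⊕ : ∀ {e f h g : Fin m} → g ∈ ⊥ {m} ⊕ e ⊕ f ⊕ h → g ≡ e ⊎ g ≡ f ⊎ g ≡ h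
  ∈⊥⊕⊕⊕ {e} {f} g∈ with ∈-⊕⁻ {S = ⊥ ⊕ e ⊕ f} g∈
  ... | inj₂ g≡h = inj₂ (inj₂ g≡h)
  ... | inj₁ g∈′ with ∈⊥⊕⊕ g∈′
  ...   | inj₁ g≡e = inj₁ g≡e
  ...   | inj₂ g≡f = inj₂ (inj₁ g≡f)

  ∣⊥⊕∣ : ∀ e → ∣ ⊥ {m} ⊕ e ∣ ≡ 1
  ∣⊥⊕∣ e = trans (∣⊕∣ {S = ⊥ {m}} {e} ∉⊥) (cong suc (∣⊥∣≡0 m))

  ∣⊥⊕⊕∣ : ∀ {e f} → f ≢ e → ∣ ⊥ {m} ⊕ e ⊕ f ∣ ≡ 2
  ∣⊥⊕⊕∣ {e} {f} f≢e = trans (∣⊕∣ {S = ⊥ ⊕ e} {f} (∉-⊕ {S = ⊥} ∉⊥ f≢e)) (cong suc (∣⊥⊕∣ e))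

  ∣⊥⊕⊕⊕∣ : ∀ {e f h} → f ≢ e → h ≢ e → h ≢ f → ∣ ⊥ {m} ⊕ e ⊕ f ⊕ h ∣ ≡ 3
  ∣⊥⊕⊕⊕∣ {e} {f} {h} f≢e h≢e h≢f =
    trans (∣⊕∣ {S = ⊥ ⊕ e ⊕ f} {h} (∉-⊕ {S = ⊥ ⊕ e} (∉-⊕ {S = ⊥} ∉⊥ h≢e) h≢f)) (cong suc (∣⊥⊕⊕∣ f≢e))

  θ₁ : ∀ e → θ G (⊥ ⊕ e) ↭ lower e ∷ upper e ∷ []
  θ₁ e = θ-complete {⊥ ⊕ e} (child e ∷ r ∷ [])
    (((child-below e ∘ R-sym) ∷ []) ∷ [] ∷ []) (cong suc (sym (∣⊥⊕∣ e)))

  module _ {e f : Fin m} (e≢f : e ≢ f) where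

    private
      S₂ : Subset m
      S₂ = ⊥ ⊕ e ⊕ f
      e∈ : e ∈ S₂
      e∈ = ⊆-⊕ {S = ⊥ ⊕ e} f (∈-⊕ {S = ⊥} e)
      f∈ : f ∈ S₂
      f∈ = ∈-⊕ {S = ⊥ ⊕ e} f

    θ₂-nested : e ⊒ f → ∃[ t ] θ G (⊥ ⊕ e ⊕ f) ↭ lower f ∷ upper e ∷ t ∷ []
    θ₂-nested e⊒f =
      let t , θS = θ-all-but-one {S₂} (child f ∷ r ∷ [])
            (((root-child {S₂} f∈ ∘ R-sym) ∷ []) ∷ [] ∷ []) (sym (∣⊥⊕⊕∣ (e≢f ∘ sym)))
      in t , ↭-trans θS (↭-reflexive (cong₂ (λ x y → x ∷ y ∷ t ∷ [])
           (sz-child f∈ λ g∈ g≢f → case ∈⊥⊕⊕ g∈ of λ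
             { (inj₁ refl) → ⊒-asym e≢f e⊒f ; (inj₂ refl) → contradiction refl g≢f })
           (sz-root e∈ λ g∈ g≢e → case ∈⊥⊕⊕ g∈ of λ
             { (inj₁ refl) → contradiction refl g≢e ; (inj₂ refl) → e⊒f })))

    θ₂-disjoint : ¬ e ⊒ f → ¬ f ⊒ e → ∃[ t ] θ G (⊥ ⊕ e ⊕ f) ↭ lower f ∷ lower e ∷ t ∷ []
    θ₂-disjoint ¬e⊒f ¬f⊒e =
      let t , θS = θ-all-but-one {S₂} (child f ∷ child e ∷ [])
            ((child-child {S₂} f∈ ¬f⊒e ∷ []) ∷ [] ∷ []) (sym (∣⊥⊕⊕∣ (e≢f ∘ sym)))
      in t , ↭-trans θS (↭-reflexive (cong₂ (λ x y → x ∷ y ∷ t ∷ [])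
           (sz-child f∈ λ g∈ g≢f → case ∈⊥⊕⊕ g∈ of λ
             { (inj₁ refl) → ¬f⊒e ; (inj₂ refl) → contradiction refl g≢f })
           (sz-child e∈ λ g∈ g≢e → case ∈⊥⊕⊕ g∈ of λ
             { (inj₁ refl) → contradiction refl g≢e ; (inj₂ refl) → ¬e⊒f })))

  -- The root is the leaf cut off by `o`, so `o` lies above every edge.
  module _ {o : Fin m} (alone : sz (⊥ ⊕ o) r ≡ 1) where

    o⊒ : ∀ e → o ⊒ e
    o⊒ e q = child-below e (subst (R (⊥ ⊕ e) r) (sym (sz≡1⇒isolated alone _ q)) ε)

    ¬⊒o : ∀ {e} → e ≢ o → ¬ e ⊒ o
    ¬⊒o {e} e≢o = ⊒-asym (e≢o ∘ sym) (o⊒ e)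

    sz-r : ∀ {S} → o ∈ S → sz S r ≡ 1
    sz-r {S} o∈S = trans (sz-root o∈S λ {g} _ _ → o⊒ g) alone

    -- For `e` other than `o`, these are the vertices not below `e`, apart from the root: n - 1 -
    -- `lower e` of them.
    middle : Fin m → ℕ
    middle e = sz (⊥ ⊕ o ⊕ e) (child o)

    θ₂-root : ∀ {e} → e ≢ o → θ G (⊥ ⊕ o ⊕ e) ↭ 1 ∷ lower e ∷ middle e ∷ []
    θ₂-root {e} e≢o = ↭-trans
      (θ-complete {S₂} (r ∷ child e ∷ child o ∷ [])
        ((root-child {S₂} e∈ ∷ root-child {S₂} o∈ ∷ []) ∷ (child-child {S₂} e∈ (¬⊒o e≢o) ∷ []) ∷ [] ∷ [])
        (cong suc (sym (∣⊥⊕⊕∣ e≢o))))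
      (↭-reflexive (cong₂ (λ x y → x ∷ y ∷ middle e ∷ []) (sz-r {S₂} o∈)
        (sz-child {S₂} e∈ λ g∈ g≢e → case ∈⊥⊕⊕ g∈ of λ
          { (inj₁ refl) → ¬⊒o e≢o ; (inj₂ refl) → contradiction refl g≢e })))
      where
      S₂ : Subset m
      S₂ = ⊥ ⊕ o ⊕ e
      o∈ : o ∈ S₂
      o∈ = ⊆-⊕ {S = ⊥ ⊕ o} e (∈-⊕ {S = ⊥} o)
      e∈ : e ∈ S₂
      e∈ = ∈-⊕ {S = ⊥ ⊕ o} e

    module _ {e f : Fin m} (e≢o : e ≢ o) (f≢o : f ≢ o) (e≢f : e ≢ f) where

      private
        S₂ : Subset m
        S₂ = ⊥ ⊕ o ⊕ e
        S₃ : Subset m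
        S₃ = ⊥ ⊕ o ⊕ e ⊕ f
        o∈ : o ∈ S₃
        o∈ = ⊆-⊕ {S = S₂} f (⊆-⊕ {S = ⊥ ⊕ o} e (∈-⊕ {S = ⊥} o))
        e∈₂ : e ∈ S₂
        e∈₂ = ∈-⊕ {S = ⊥ ⊕ o} e
        e∈ : e ∈ S₃
        e∈ = ⊆-⊕ {S = S₂} f e∈₂
        f∈ : f ∈ S₃
        f∈ = ∈-⊕ {S = S₂} f

        sz-f : ¬ f ⊒ e → sz S₃ (child f) ≡ lower f
        sz-f ¬f⊒e = sz-child {S₃} f∈ λ g∈ g≢f → case ∈⊥⊕⊕⊕ g∈ of λ
          { (inj₁ refl) → ¬⊒o f≢o
          ; (inj₂ (inj₁ refl)) → ¬f⊒e
          ; (inj₂ (inj₂ refl)) → contradiction refl g≢f }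

      -- As in `θ₂-nested`, but with the root split off from the part above `e`. Since `f` lies
      -- below `e`, its removal leaves `middle e` unchanged.
      θ₃-nested : e ⊒ f → ∃[ t ] θ G (⊥ ⊕ o ⊕ e ⊕ f) ↭ lower f ∷ 1 ∷ middle e ∷ t ∷ []
      θ₃-nested e⊒f =
        let t , θS = θ-all-but-one {S₃} (child f ∷ r ∷ child o ∷ [])
              (((root-child {S₃} f∈ ∘ R-sym) ∷ child-child {S₃} f∈ (¬⊒o f≢o) ∷ [])
                ∷ (root-child {S₃} o∈ ∷ []) ∷ [] ∷ [])
              (sym (∣⊥⊕⊕⊕∣ e≢o f≢o (e≢f ∘ sym)))
        in t , ↭-trans θS (↭-reflexive (trans
             (cong (λ x → x ∷ sz S₃ r ∷ sz S₃ (child o) ∷ t ∷ []) (sz-f (⊒-asym e≢f e⊒f)))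
             (cong₂ (λ x y → lower f ∷ x ∷ y ∷ t ∷ []) (sz-r {S₃} o∈)
               (sz-stable {S₂} {S₃} (⊆-⊕ {S = S₂} f) (far-⊕ {S₂} far)))))
        where
        far : ∀ {x y} → Joins (ends G f) x y → ¬ R S₂ (child o) x
        far j q = e⊒f (¬below⇒R (¬⊒o e≢o) ◅◅ R-mono (⊥⊕-⊆ e∈₂) q ◅◅ end⇝child (e≢f ∘ sym) j)

      θ₃-disjoint : ¬ e ⊒ f → ¬ f ⊒ e → ∃[ t ] θ G (⊥ ⊕ o ⊕ e ⊕ f) ↭ lower f ∷ 1 ∷ lower e ∷ t ∷ []
      θ₃-disjoint ¬e⊒f ¬f⊒e =
        let t , θS = θ-all-but-one {S₃} (child f ∷ r ∷ child e ∷ [])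
              (((root-child {S₃} f∈ ∘ R-sym) ∷ child-child {S₃} f∈ ¬f⊒e ∷ [])
                ∷ (root-child {S₃} e∈ ∷ []) ∷ [] ∷ [])
              (sym (∣⊥⊕⊕⊕∣ e≢o f≢o (e≢f ∘ sym)))
        in t , ↭-trans θS (↭-reflexive (trans
             (cong (λ x → x ∷ sz S₃ r ∷ sz S₃ (child e) ∷ t ∷ []) (sz-f ¬f⊒e))
             (cong₂ (λ x y → lower f ∷ x ∷ y ∷ t ∷ []) (sz-r {S₃} o∈)
               (sz-child {S₃} e∈ λ g∈ g≢e → case ∈⊥⊕⊕⊕ g∈ of λ
                 { (inj₁ refl) → ¬⊒o e≢o
                 ; (inj₂ (inj₁ refl)) → contradiction refl g≢e
                 ; (inj₂ (inj₂ refl)) → ¬e⊒f }))))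

-- Arithmetic of coinciding partitions

pair-↭ : ∀ {a b c d : ℕ} → a ∷ b ∷ [] ↭ c ∷ d ∷ [] → c ≡ a ⊎ c ≡ b
pair-↭ eq with ∈-resp-↭ (↭-sym eq) (here refl)
... | here c≡a         = inj₁ c≡a
... | there (here c≡b) = inj₂ c≡b

-- If `c` were `t`, the two totals would differ by `z`. The summand `x` is 0 for two removed edges
-- and 1, the root, for three.
pair-of-parts : ∀ {z d t c t′ x n} → 1 ≤ z → x + (z + (d + (t + 0))) ≡ n → x + (d + c) ≡ n →
  d ∷ t ∷ [] ↭ c ∷ t′ ∷ [] → c ≡ d
pair-of-parts {z} {d} {t} {c} {x = x} 1≤z total total′ eq with pair-↭ eq
... | inj₁ c≡d  = c≡d
... | inj₂ refl = contradiction
  (trans (cong (λ w → z + (d + w)) (sym (+-identityʳ t))) (+-cancelˡ-≡ x _ _ (trans total (sym total′))))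
  (>⇒≢ (m<n+m (d + t) 1≤z))

both-totals : ∀ {c d u n} → c + (d + 0) ≡ n → 1 + (c + (u + 0)) ≡ n → u ≢ d
both-totals {c} {d} total₁ total₂ refl = contradiction
  (+-cancelˡ-≡ c _ _ (trans total₁ (trans (sym total₂) (sym (+-suc c (d + 0))))))
  (1+n≢n ∘ sym)

-- The first pair leaves `c` or `d` for `c′`, the second `c` or `u`; the totals rule out `d` = `u`.
common-part : ∀ {c d u c′ d′ u′ n} → c ∷ d ∷ [] ↭ c′ ∷ d′ ∷ [] → 1 ∷ c ∷ u ∷ [] ↭ 1 ∷ c′ ∷ u′ ∷ [] →
  c + (d + 0) ≡ n → 1 + (c + (u + 0)) ≡ n → c ≡ c′
common-part {c} eq₁ eq₂ total₁ total₂ with pair-↭ eq₁ | pair-↭ (drop-∷ eq₂)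
... | inj₁ c′≡c | _         = sym c′≡c
... | inj₂ _    | inj₁ c′≡c = sym c′≡c
... | inj₂ c′≡d | inj₂ c′≡u = contradiction (trans (sym c′≡u) c′≡d) (both-totals {c} total₁ total₂)

-- Here `z` is `lower f`, and `c`, `d`, `u` are `lower e`, `upper e`, `middle e`. Two removed edges
-- force `c` = `d`, that is n = 2c; three force `c` = `u`, that is n - 1 = 2c.
nested≢disjoint : ∀ {z c d u n xs ys xs′ ys′} → 1 ≤ z → c + (d + 0) ≡ n → 1 + (c + (u + 0)) ≡ n →
  sum xs ≡ n → sum ys ≡ n → xs ↭ xs′ → ys ↭ ys′ →
  (∃[ t ] xs ↭ z ∷ d ∷ t ∷ []) → (∃[ t ] xs′ ↭ z ∷ c ∷ t ∷ []) →
  (∃[ t ] ys ↭ z ∷ 1 ∷ u ∷ t ∷ []) → ¬ (∃[ t ] ys′ ↭ z ∷ 1 ∷ c ∷ t ∷ [])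
nested≢disjoint {z} {c} {d} {u} 1≤z total₁ total₂ sum-xs sum-ys xs↭ ys↭ (t , p) (t′ , p′) (s , q) (s′ , q′) =
  both-totals {c} total₁ total₂ (trans (sym c≡u) c≡d)
  where
  c≡d : c ≡ d
  c≡d = pair-of-parts {x = 0} 1≤z (trans (sym (sum-↭ p)) sum-xs) (trans (shuffle d c) total₁)
    (drop-∷ (↭-trans (↭-sym p) (↭-trans xs↭ p′)))
    where
    shuffle : ∀ d c → d + c ≡ c + (d + 0)
    shuffle = solve-∀
  c≡u : c ≡ u
  c≡u = pair-of-parts {x = 1} 1≤z
    (trans (shuffle₁ z u s) (trans (sym (sum-↭ q)) sum-ys)) (trans (shuffle₂ u c) total₂)
    (drop-∷ (drop-∷ (↭-trans (↭-sym q) (↭-trans ys↭ q′))))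
    where
    shuffle₁ : ∀ z u s → 1 + (z + (u + (s + 0))) ≡ z + (1 + (u + (s + 0)))
    shuffle₁ = solve-∀
    shuffle₂ : ∀ u c → 1 + (u + c) ≡ 1 + (c + (u + 0))
    shuffle₂ = solve-∀

-- Equality of the edge orders of both trees

module Compare {n m : ℕ} (T T′ : Graph n m) (tree : IsTree T) (tree′ : IsTree T′)
  (agree₁ : Agree T T′ 1) (agree₂ : Agree T T′ 2) (agree₃ : Agree T T′ 3)
  {o : Fin m} {r r′ : Fin n}
  (alone  : ∣ component T (⊥ ⊕ o) r ∣ ≡ 1)
  (alone′ : ∣ component T′ (⊥ ⊕ o) r′ ∣ ≡ 1) where

  module T  = Rooted T tree r
  module T′ = Rooted T′ tree′ r′

  lower-agree : ∀ {e} → e ≢ o → T.lower e ≡ T′.lower e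
  lower-agree {e} e≢o = common-part
    (↭-trans (↭-sym (T.θ₁ e)) (↭-trans (agree₁ (⊥ ⊕ e) (T.∣⊥⊕∣ e)) (T′.θ₁ e)))
    (↭-trans (↭-sym (T.θ₂-root alone e≢o))
      (↭-trans (agree₂ (⊥ ⊕ o ⊕ e) (T.∣⊥⊕⊕∣ e≢o)) (T′.θ₂-root alone′ e≢o)))
    (T.θ-sum {⊥ ⊕ e} (T.θ₁ e)) (T.θ-sum {⊥ ⊕ o ⊕ e} (T.θ₂-root alone e≢o))

  not-disjoint : ∀ {e f} → e ≢ f → e ≢ o → f ≢ o → e T.⊒ f → ¬ e T′.⊒ f → f T′.⊒ e
  -- The goal `f T′.⊒ e` is a negation: `q` refutes it, so `e` and `f` are incomparable in `T′`.
  not-disjoint {e} {f} e≢f e≢o f≢o e⊒f ¬e⊒′f q = nested≢disjoint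
    (Tree.sz-pos T tree (⊥ ⊕ f) (T.child f))
    (T.θ-sum {⊥ ⊕ e} (T.θ₁ e)) (T.θ-sum {⊥ ⊕ o ⊕ e} (T.θ₂-root alone e≢o))
    (T.θ-sum {⊥ ⊕ e ⊕ f} ↭-refl) (T.θ-sum {⊥ ⊕ o ⊕ e ⊕ f} ↭-refl)
    (agree₂ (⊥ ⊕ e ⊕ f) (T.∣⊥⊕⊕∣ (e≢f ∘ sym)))
    (agree₃ (⊥ ⊕ o ⊕ e ⊕ f) (T.∣⊥⊕⊕⊕∣ e≢o f≢o (e≢f ∘ sym)))
    (T.θ₂-nested e≢f e⊒f)
    (subst₂ (λ z c → ∃[ t ] θ T′ (⊥ ⊕ e ⊕ f) ↭ z ∷ c ∷ t ∷ []) (sym (lower-agree f≢o)) (sym (lower-agree e≢o))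
      (T′.θ₂-disjoint e≢f ¬e⊒′f (λ f⊒′e → f⊒′e q)))
    (T.θ₃-nested alone e≢o f≢o e≢f e⊒f)
    (subst₂ (λ z c → ∃[ t ] θ T′ (⊥ ⊕ o ⊕ e ⊕ f) ↭ z ∷ 1 ∷ c ∷ t ∷ []) (sym (lower-agree f≢o)) (sym (lower-agree e≢o))
      (T′.θ₃-disjoint alone′ e≢o f≢o e≢f ¬e⊒′f (λ f⊒′e → f⊒′e q)))

  nested-agree : ∀ {e f} → e T.⊒ f → e T′.⊒ f
  nested-agree {e} {f} e⊒f = by-cases (e Fin.≟ f) (e Fin.≟ o) (f Fin.≟ o)
    where
    by-cases : Dec (e ≡ f) → Dec (e ≡ o) → Dec (f ≡ o) → e T′.⊒ f
    by-cases (yes refl) _          _          = T′.child-below e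
    by-cases (no _)     (yes refl) _          = T′.o⊒ alone′ f
    by-cases (no _)     (no e≢o)   (yes refl) = contradiction e⊒f (T.¬⊒o alone e≢o)
    -- Were `e` not above `f` in `T′`, then `f` would be above `e` there, and the sizes, equal in
    -- both trees, would be ordered both ways.
    by-cases (no e≢f)   (no e≢o)   (no f≢o)   q =
      <-asym (T.⊒⇒lower< e≢f e⊒f)
        (subst₂ _<_ (sym (lower-agree e≢o)) (sym (lower-agree f≢o)) (T′.⊒⇒lower< (e≢f ∘ sym)
          (not-disjoint e≢f e≢o f≢o e⊒f (λ e⊒′f → e⊒′f q))))

-- The tree recovered from the order on its edges

module Vertices {m : ℕ} (G : Graph (suc m) m) (tree : IsTree G) (r : Fin (suc m)) where
  open Tree G tree
  open Rooted G tree r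

  vertex : Fin (suc m) → Fin (suc m)
  vertex zero    = r
  vertex (suc e) = child e

  ⊒-antisym : ∀ {e f} → e ⊒ f → f ⊒ e → e ≡ f
  ⊒-antisym {e} {f} e⊒f f⊒e = decidable-stable (e Fin.≟ f) λ e≢f → ⊒-asym e≢f e⊒f f⊒e

  -- A vertex is known from the edges above it: the root has none, and the lower end of an edge has
  -- that edge as the lowest.
  vertex-determined : ∀ i j → (∀ e → Below e (vertex i) → Below e (vertex j)) →
    (∀ e → Below e (vertex j) → Below e (vertex i)) → i ≡ j
  vertex-determined zero    zero    _ _ = refl
  vertex-determined zero    (suc f) _ g = contradiction ε (g f (child-below f))
  vertex-determined (suc e) zero    g _ = contradiction ε (g e (child-below e))
  vertex-determined (suc e) (suc f) g h = cong suc (⊒-antisym (g e (child-below e)) (h f (child-below f)))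

  vertex-injective : ∀ {i j} → vertex i ≡ vertex j → i ≡ j
  vertex-injective {i} {j} eq = vertex-determined i j (λ e → subst (Below e) eq) (λ e → subst (Below e) (sym eq))

  -- Pigeonhole: if `v` were missed, punching it out would inject `Fin (suc m)` into `Fin m`.
  vertex-surjective : ∀ v → ∃[ i ] vertex i ≡ v
  vertex-surjective v with Fin.any? (λ i → vertex i Fin.≟ v)
  ... | yes hit  = hit
  ... | no  miss = contradiction
    (λ {i} {j} eq → vertex-injective (Fin.punchOut-injective (missed i) (missed j) eq))
    (Fin.<⇒notInjective (n<1+n m))
    where
    missed : ∀ i → v ≢ vertex i
    missed i eq = miss (i , sym eq)

  index : Fin (suc m) → Fin (suc m)
  index v = proj₁ (vertex-surjective v)

  vertex-index : ∀ v → vertex (index v) ≡ v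
  vertex-index v = proj₂ (vertex-surjective v)

  index-vertex : ∀ i → index (vertex i) ≡ i
  index-vertex i = vertex-injective (vertex-index (vertex i))

  below-top : ∀ {e g} → Below g (top e) → g ≢ e × g ⊒ e
  below-top {e} {g} b = g≢e , λ q → b (q ◅◅ edge (∉-⊕ {S = ⊥} ∉⊥ (g≢e ∘ sym)) (Joins-sym (joins e)))
    where
    g≢e : g ≢ e
    g≢e refl = b (r⇝top e)

  below-top⁻ : ∀ {e g} → g ≢ e → g ⊒ e → Below g (top e)
  below-top⁻ {e} {g} g≢e g⊒e q = g⊒e (q ◅◅ edge (∉-⊕ {S = ⊥} ∉⊥ (g≢e ∘ sym)) (joins e))

module Isomorphism {m : ℕ} (T T′ : Graph (suc m) m) (tree : IsTree T) (tree′ : IsTree T′)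
  (r r′ : Fin (suc m)) where

  module T  = Rooted T tree r
  module T′ = Rooted T′ tree′ r′
  module V  = Vertices T tree r
  module V′ = Vertices T′ tree′ r′

  transport : Fin (suc m) → Fin (suc m)
  transport v = V′.vertex (V.index v)

  module _ (⊒⇒ : ∀ {e f} → e T.⊒ f → e T′.⊒ f) (⊒⇐ : ∀ {e f} → e T′.⊒ f → e T.⊒ f) where

    below⇒ : ∀ e i → T.Below e (V.vertex i) → T′.Below e (V′.vertex i)
    below⇒ e zero    b = contradiction ε b
    below⇒ e (suc f) b = ⊒⇒ b

    below⇐ : ∀ e i → T′.Below e (V′.vertex i) → T.Below e (V.vertex i)
    below⇐ e zero    b = contradiction ε b
    below⇐ e (suc f) b = ⊒⇐ b

    transport-child : ∀ e → transport (T.child e) ≡ T′.child e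
    transport-child e = cong V′.vertex (V.index-vertex (suc e))

    -- The edges above `top e` are those strictly above `e`. They are the same in both trees and
    -- determine the vertex.
    transport-top : ∀ e → transport (T.top e) ≡ T′.top e
    transport-top e = trans (cong V′.vertex (V.vertex-determined (V.index (T.top e)) j to from)) (V′.vertex-index (T′.top e))
      where
      j = V′.index (T′.top e)
      to : ∀ g → T.Below g (V.vertex (V.index (T.top e))) → T.Below g (V.vertex j)
      to g b = let g≢e , g⊒e = V.below-top (subst (T.Below g) (V.vertex-index _) b) in
        below⇐ g j (subst (T′.Below g) (sym (V′.vertex-index _)) (V′.below-top⁻ g≢e (⊒⇒ g⊒e)))
      from : ∀ g → T.Below g (V.vertex j) → T.Below g (V.vertex (V.index (T.top e)))
      from g b = let g≢e , g⊒e = V′.below-top (subst (T′.Below g) (V′.vertex-index _) (below⇒ g j b)) in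
        subst (T.Below g) (sym (V.vertex-index _)) (V.below-top⁻ g≢e (⊒⇐ g⊒e))

    transport-adjacent : ∀ {u v} → Adjacent T u v → Adjacent T′ (transport u) (transport v)
    transport-adjacent (e , e∉ , j) = e , e∉ , (case Joins-ends (T.joins e) j of λ
      { (inj₁ (refl , refl)) → image
      ; (inj₂ (refl , refl)) → Joins-sym image })
      where
      image : Joins (ends T′ e) (transport (T.top e)) (transport (T.child e))
      image = subst₂ (Joins (ends T′ e)) (sym (transport-top e)) (sym (transport-child e)) (T′.joins e)

same-order⇒isomorphic : ∀ {m} (T T′ : Graph (suc m) m) (tree : IsTree T) (tree′ : IsTree T′) r r′ →
  (let open Rooted T tree r; open Rooted T′ tree′ r′ renaming (_⊒_ to _⊒′_)) →
  (∀ {e f} → e ⊒ f → e ⊒′ f) → (∀ {e f} → e ⊒′ f → e ⊒ f) → Isomorphic T T′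
same-order⇒isomorphic T T′ tree tree′ r r′ ⊒⇒ ⊒⇐ =
  permutation I.transport I⁻.transport there-back back-there , λ u v → mk⇔
    (I.transport-adjacent ⊒⇒ ⊒⇐)
    (λ a → subst₂ (Adjacent T) (back-there u) (back-there v) (I⁻.transport-adjacent ⊒⇐ ⊒⇒ a))
  where
  module I  = Isomorphism T T′ tree tree′ r r′
  module I⁻ = Isomorphism T′ T tree′ tree r′ r
  there-back : ∀ v → I.transport (I⁻.transport v) ≡ v
  there-back v = trans (cong I.V′.vertex (I.V.index-vertex (I.V′.index v))) (I.V′.vertex-index v)
  back-there : ∀ v → I⁻.transport (I.transport v) ≡ v
  back-there v = trans (cong I.V.vertex (I.V′.index-vertex (I.V.index v))) (I.V.vertex-index v)

-- A common leaf edge and the conclusion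

leaf-root : (T T′ : Graph n m) → IsTree T → IsTree T′ → Agree T T′ 1 → Fin m →
  ∃[ o ] (∃[ r ] ∣ component T (⊥ ⊕ o) r ∣ ≡ 1) × (∃[ r′ ] ∣ component T′ (⊥ ⊕ o) r′ ∣ ≡ 1)
leaf-root T T′ tree tree′ agree₁ e
  with o , l , lf , _ ← Tree.leaf-beyond T tree {⊥} {e} ∉⊥ (inj₁ refl)
  = o , (l , Tree.Leaf.alone lf)
  -- A leaf edge is recognised by a part 1 after its removal, so by agreement `o` is a leaf edge of
  -- `T′` too.
  , (let r′ , one = Tree.∈-θ⁻ T′ tree′ {⊥ ⊕ o} (∈-resp-↭ (agree₁ (⊥ ⊕ o) (Rooted.∣⊥⊕∣ T tree l o)) (1∈θ lf)) in
     r′ , sym one)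
  where
  1∈θ : ∀ {o l} → Tree.Leaf T tree ⊥ o l → 1 ∈ˡ θ T (⊥ ⊕ o)
  1∈θ (Tree.leaf o∉ j one) = ∈-resp-↭ (↭-sym (proj₂ (proj₂ (Tree.θ-split T tree o∉ j)))) (there (here (sym one)))

agreement⇒isomorphic : ∀ {m} (T T′ : Graph (suc m) m) → IsTree T → IsTree T′ →
  Agree T T′ 1 → Agree T T′ 2 → Agree T T′ 3 → Fin m → Isomorphic T T′
agreement⇒isomorphic {m} T T′ tree tree′ agree₁ agree₂ agree₃ e =
  rooted (leaf-root T T′ tree tree′ agree₁ e)
  where
  flip : ∀ {j} → Agree T T′ j → Agree T′ T j
  flip agree S ∣S∣≡j = ↭-sym (agree S ∣S∣≡j)
  rooted : ∃[ o ] (∃[ r ] ∣ component T (⊥ ⊕ o) r ∣ ≡ 1) × (∃[ r′ ] ∣ component T′ (⊥ ⊕ o) r′ ∣ ≡ 1) →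
    Isomorphic T T′
  rooted (o , (r , alone) , (r′ , alone′)) = same-order⇒isomorphic T T′ tree tree′ r r′
    (Compare.nested-agree T T′ tree tree′ agree₁ agree₂ agree₃ {o} alone alone′)
    (Compare.nested-agree T′ T tree′ tree (flip agree₁) (flip agree₂) (flip agree₃) {o} alone′ alone)

corollary2p4 : (n k : ℕ) → 4 ≤ n → 3 ≤ k → k ≤ n ∸ 3 →
    (T T′ : Graph n (n ∸ 1)) → IsTree T → IsTree T′ →
    ((I : Subset (n ∸ 1)) → ∣ I ∣ ≡ k → θ T I ↭ θ T′ I) →
    Isomorphic T T′
corollary2p4 (suc zero) k (s≤s ())
corollary2p4 (suc (suc m)) k 4≤n 3≤k k≤ T T′ tree tree′ agree =
  -- There are at least two vertices, so `zero` is an edge, from which the search for a leaf edge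
  -- starts.
  agreement⇒isomorphic T T′ tree tree′ (level 1 (s≤s z≤n)) (level 2 (s≤s (s≤s z≤n))) (level 3 ≤-refl) zero
  where
  level : ∀ j → j ≤ 3 → Agree T T′ j
  level j j≤3 = agree-below T T′ tree tree′ (k ∸ j)
    (≤-trans (≤-reflexive (cong (_+ 3) k∸j+j)) (≤-trans (+-monoˡ-≤ 3 k≤) (≤-reflexive (m∸n+n≡m (≤-trans (n≤1+n 3) 4≤n)))))
    λ S ∣S∣≡ → agree S (trans ∣S∣≡ k∸j+j)
    where
    k∸j+j : k ∸ j + j ≡ k
    k∸j+j = m∸n+n≡m (≤-trans j≤3 3≤k)
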